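{- Let $k$ be an odd positive integer, let $\ell$ be a positive integer and let $m$ be a nonnegative integer with $m\leq k$. Let $0<i_1<i_2<\dotsb<i_m<\ell$ be integers, and suppose the caterpillar tree $CP_\ell^{i_1,i_2,\dotsc,i_m}$ is not $CP_4^{1,3}$. Then $CP_\ell^{i_1,i_2,\dotsc,i_m}$ can be embedded in $K_k^*$ if and only if $\ell+m\leq\binom{k+1}{2}$.
   Context: $K_k^*$ denotes the complete graph $K_k$ on vertices $v_0,\dotsc,v_{k-1}$ with a loop $v_iv_i$ added at every vertex; it has $\binom{k+1}{2}$ edges. An embedding of a graph $G$ (simple graph possibly with at most one loop per vertex) in $K_k^*$ is a map $f:V(G)\to V(K_k^*)$ such that each edge $uv$ of $G$ is sent to the edge $f(u)f(v)$ of $K_k^*$ (a loop if $f(u)=f(v)$), and the induced map $E(G)\to E(K_k^*)$ is injective. For a positive integer $\ell$, a nonnegative integer $m$ and integers $0<i_1\leq\dotsb\leq i_m<\ell$, the caterpillar tree $CP_\ell^{i_1,\dotsc,i_m}$ is the tree with vertices $y_0,\dotsc,y_{\ell+m}$ consisting of the path $y_0y_1\dotsb y_\ell$ together with the $m$ extra edges $y_{\ell+1}y_{i_1},y_{\ell+2}y_{i_2},\dotsc,y_{\ell+m}y_{i_m}$. -}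

module Defs where

open import Data.Nat using (ℕ; zero; suc; _+_; _*_; _<_; _≤_)
open import Data.Nat.Combinatorics using (_C_)
open import Data.Fin using (Fin; toℕ; _↑ˡ_; _↑ʳ_; inject₁) renaming (suc to fsuc; zero to fzero)
open import Data.Sum using (_⊎_; inj₁; inj₂)
open import Data.Product using (_×_; _,_; Σ)
open import Relation.Binary.PropositionalEquality using (_≡_; refl)

-- A (finite) graph, possibly with loops, given by its vertex set Fin n and an
-- indexed family of edges (each edge given by its two endpoints; the edge
-- {u,v} is unordered, a loop when u ≡ v).
record Graph : Set₁ where
  field
    nV    : ℕ
    EIdx  : Set
    ends  : EIdx → Fin nV × Fin nV

open Graph public

SamePair : ∀ {k} → Fin k × Fin k → Fin k × Fin k → Set
SamePair (a , b) (c , d) = (a ≡ c × b ≡ d) ⊎ (a ≡ d × b ≡ c)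

-- Image of an edge under a vertex map (as an unordered pair of vertices of K_k^*,
-- i.e. an edge of K_k^*; every unordered pair, including {v,v}, is an edge).
imgEdge : ∀ {k} (G : Graph) → (Fin (nV G) → Fin k) → EIdx G → Fin k × Fin k
imgEdge G f e with ends G e
... | (u , v) = f u , f v

-- Embedding of G in K_k^*: a vertex map whose induced map on edges is injective.
-- (Edges of K_k^* are unordered pairs of vertices of Fin k, loops allowed.)
IsEmbedding : ∀ (G : Graph) (k : ℕ) → (Fin (nV G) → Fin k) → Set
IsEmbedding G k f =
  ∀ (e e′ : EIdx G) → SamePair (imgEdge G f e) (imgEdge G f e′) → e ≡ e′

EmbedsIn : Graph → ℕ → Set
EmbedsIn G k = Σ (Fin (nV G) → Fin k) (IsEmbedding G k)

-- The caterpillar CP_ℓ^{i_1,…,i_m}, with i given as a function Fin m → Fin ℓ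
-- (i t = i_{t+1}). Vertices y_0,…,y_{ℓ+m} are Fin (suc ℓ + m): y_j (j ≤ ℓ)
-- is inject+ m j and y_{ℓ+1+t} is (suc ℓ ↑ʳ t).
-- Edges: path edges y_j y_{j+1} (j < ℓ) and leaf edges y_{ℓ+1+t} y_{i t}.
caterpillar : (ℓ m : ℕ) → (Fin m → Fin ℓ) → Graph
caterpillar ℓ m i = record
  { nV   = suc ℓ + m
  ; EIdx = Fin ℓ ⊎ Fin m
  ; ends = λ { (inj₁ j) → (inject₁ j ↑ˡ m) , (fsuc j ↑ˡ m)
             ; (inj₂ t) → (suc ℓ ↑ʳ t) , (inject₁ (i t) ↑ˡ m) }
  }

StrictlyIncreasing : ∀ {m ℓ} → (Fin m → Fin ℓ) → Set
StrictlyIncreasing {m} i = ∀ (s t : Fin m) → toℕ s < toℕ t → toℕ (i s) < toℕ (i t)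

AllPositive : ∀ {m ℓ} → (Fin m → Fin ℓ) → Set
AllPositive {m} i = ∀ (t : Fin m) → 0 < toℕ (i t)

IsCP4-13 : (ℓ m : ℕ) → (Fin m → Fin ℓ) → Set
IsCP4-13 ℓ m i =
  Σ (ℓ ≡ 4) λ _ → Σ (m ≡ 2) λ { refl →
    Σ (toℕ (i fzero) ≡ 1) λ _ → toℕ (i (fsuc fzero)) ≡ 3 }

OddNat : ℕ → Set
OddNat k = Σ ℕ λ j → k ≡ suc (2 * j)

{-# OPTIONS --safe #-}

-- Necessity counts edges.  For sufficiency lengthen the spine until
-- ℓ + m = k (k + 1) / 2 and use the loops of K_k^* for the leaves and, in
-- addition, for k - m pairs of consecutive spine vertices.  After contracting
-- these pairs one needs an Euler tour of K_k with k prescribed positions ("marks")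
-- carrying distinct vertices.  For this, two vertices are inserted into a tour of
-- K_{k-2}: an edge w₀w₁ is replaced by w₀ X w₁ w₀ X′ w₁, a segment of 2 k - 1 bits
-- within a window of length 2 k + 1.  Such a window with exactly four marks exists
-- by a discrete intermediate value argument, and since gaps between marks can be
-- lengthened by 4, a finite table shows that it admits an insertion.  The
-- induction starts at k = 7, where K_5 has two exceptional mark patterns that must
-- be avoided; for k = 5 these need leaf edges other than loops, and for k = 3
-- only CP_4^{1,3} cannot be drawn.
module Submission where

open import Defs
open import Algebra.Solver.CommutativeMonoid as Solver using ()
open import Data.Bool.Base using (Bool; true; false; not; _∧_; _∨_; T)
open import Data.Bool.Properties using (T-∧; T-∨)
open import Data.Empty using (⊥; ⊥-elim)
open import Data.Fin.Base using (Fin; toℕ; fromℕ<; splitAt; join; _↑ˡ_; _↑ʳ_; inject₁) renaming (zero to fzero; suc to fsuc)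
open import Data.Fin.Properties using (toℕ<n; toℕ-fromℕ<; toℕ-injective; toℕ-inject₁; splitAt-↑ˡ; splitAt-↑ʳ; join-splitAt; injective⇒≤)
open import Data.List.Base using (List; []; _∷_; _++_; [_]; length; map; take; drop; _∷ʳ_; initLast; _∷ʳ′_)
open import Data.List.Membership.Propositional using (_∈_; _∉_)
open import Data.List.Membership.Propositional.Properties using (∈-∃++; ∈-++⁺ˡ; ∈-++⁺ʳ; ∈-++⁻; ∈-upTo⁺; ∈-upTo⁻; ∈-map⁻)
open import Data.List.Properties using (++-assoc; ++-identityʳ; length-++; length-upTo; map-++; take++drop≡id)
open import Data.List.Relation.Binary.Permutation.Propositional
  using (_↭_; prep; ↭-refl; ↭-reflexive; ↭-sym; ↭-trans; ↭⇒↭ₛ)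
open import Data.List.Relation.Binary.Permutation.Propositional.Properties
  using (↭-length; All-resp-↭; ++⁺ˡ; ++⁺ʳ; ++⁺; shift; ++-comm; ++-commutativeMonoid; map⁺; drop-∷)
import Data.List.Relation.Binary.Permutation.Setoid.Properties as SetoidPermutation
open import Data.List.Relation.Unary.All as All using (All; []; _∷_; all?)
import Data.List.Relation.Unary.All.Properties as Allₚ
open import Data.List.Relation.Unary.AllPairs using ([]; _∷_; allPairs?)
open import Data.List.Relation.Unary.Any using (here; there)
open import Data.List.Relation.Unary.Unique.Propositional using (Unique)
open import Data.List.Relation.Unary.Unique.Propositional.Properties using (upTo⁺) renaming (map⁺ to Unique-map⁺)
open import Data.Maybe.Base using (Maybe; just; nothing; is-just)
open import Data.Nat.Base
open import Data.Nat.Combinatorics using (_C_; nC1≡n; nCk+nC[k+1]≡[n+1]C[k+1])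
open import Data.Nat.DivMod using (_%_; _/_; [m+n]%n≡m%n; [m+kn]%n≡m%n; m<n⇒m%n≡m; m≡m%n+[m/n]*n; m%n<n)
open import Data.Nat.Properties
open import Data.Nat.Tactic.RingSolver using (solve-∀)
open import Data.Product.Base using (Σ; ∃; ∃-syntax; _×_; _,_; proj₁; proj₂)
open import Data.Product.Properties using (≡-dec)
open import Data.Sum.Base using (_⊎_; inj₁; inj₂)
open import Data.Unit.Base using (tt)
open import Data.Vec.Base as Vec using (Vec; []; _∷_; toList; fromList)
open import Data.Vec.Properties using (toList∘fromList; length-toList)
open import Function.Base using (_∘_; id; case_of_)
open import Function.Bundles using (_⇔_; mk⇔; Equivalence)
open import Relation.Binary.Definitions using (tri<; tri≈; tri>)
open import Relation.Binary.PropositionalEquality hiding ([_])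
open import Relation.Nullary using (¬_; Dec; yes; no; ¬?)
open import Relation.Nullary.Decidable using (True; toWitness; _×-dec_)


-- Edges, closed walks and marked tours

-- The trail w₀ X w₁ w₀ X′ w₁ keeps the old edge, traversed backwards between X and X′, and adds
-- exactly the edges at the two new vertices. The order in which the other old vertices occur in X
-- and X′ is arbitrary, so only the pattern of marks matters, and whether an insertion exists
-- becomes a question about an automaton reading the bits of the window.
--
-- Four is the number of marks that a segment absorbs by itself: one on each new vertex and at most
-- one on each of w₀ and w₁. A mark at another old vertex must come from a position next to the
-- segment that is marked in the smaller tour and unmarked in the larger one; the two extra bits of
-- the window show whether such a position is available and let the segment slide.
--
-- Marks have density 2 / (k - 1), so a window of length 2 k + 1 carries 4 + 6 / (k - 1) of them on
-- average. For k > 7 this lies strictly between 4 and 5, which forces a window with exactly four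
-- marks. For k = 7 it equals 5, and the words in which every window has five marks have period 3
-- and are treated separately.

Edge : Set
Edge = ℕ × ℕ

-- With the larger end first, equality of unordered pairs is propositional and decidable, and an
-- edge between a new and an old vertex has the normal form (new , old).
edge : ℕ → ℕ → Edge
edge u v = u ⊔ v , u ⊓ v

Proper : Edge → Set
Proper e = proj₁ e ≢ proj₂ e

edge-comm : ∀ u v → edge u v ≡ edge v u
edge-comm u v = cong₂ _,_ (⊔-comm u v) (⊓-comm u v)

edge-> : ∀ {u v} → v < u → edge u v ≡ (u , v)
edge-> v<u = cong₂ _,_ (m≥n⇒m⊔n≡m (<⇒≤ v<u)) (m≥n⇒m⊓n≡n (<⇒≤ v<u))

edge-injective : ∀ u v x y → edge u v ≡ edge x y → (u ≡ x × v ≡ y) ⊎ (u ≡ y × v ≡ x)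
edge-injective u v x y eq with ≤-total u v | ≤-total x y
... | inj₁ p | inj₁ q
  rewrite m≤n⇒m⊔n≡n p | m≤n⇒m⊓n≡m p | m≤n⇒m⊔n≡n q | m≤n⇒m⊓n≡m q
  = inj₁ (cong proj₂ eq , cong proj₁ eq)
... | inj₁ p | inj₂ q
  rewrite m≤n⇒m⊔n≡n p | m≤n⇒m⊓n≡m p | m≥n⇒m⊔n≡m q | m≥n⇒m⊓n≡n q
  = inj₂ (cong proj₂ eq , cong proj₁ eq)
... | inj₂ p | inj₁ q
  rewrite m≥n⇒m⊔n≡m p | m≥n⇒m⊓n≡n p | m≤n⇒m⊔n≡n q | m≤n⇒m⊓n≡m q
  = inj₂ (cong proj₁ eq , cong proj₂ eq)
... | inj₂ p | inj₂ q
  rewrite m≥n⇒m⊔n≡m p | m≥n⇒m⊓n≡n p | m≥n⇒m⊔n≡m q | m≥n⇒m⊓n≡n q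
  = inj₁ (cong proj₁ eq , cong proj₂ eq)

proper⇒≢ : ∀ {u v} → Proper (edge u v) → u ≢ v
proper⇒≢ {u} p refl = p (trans (⊔-idem u) (sym (⊓-idem u)))

walk : ℕ → List ℕ → List Edge
walk u [] = []
walk u (v ∷ vs) = edge u v ∷ walk v vs

closed : List ℕ → List Edge
closed [] = []
closed (v ∷ vs) = walk v (vs ++ [ v ])

walk-++ : ∀ u xs x ys → walk u (xs ++ x ∷ ys) ≡ walk u (xs ++ [ x ]) ++ walk x ys
walk-++ u [] x ys = refl
walk-++ u (y ∷ xs) x ys = cong (edge u y ∷_) (walk-++ y xs x ys)

when : Bool → ℕ → List ℕ
when true v = [ v ]
when false v = []

select : List Bool → List ℕ → List ℕ
select (b ∷ bs) (v ∷ vs) = when b v ++ select bs vs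
select _ _ = []

count : List Bool → ℕ
count [] = 0
count (true ∷ bs) = suc (count bs)
count (false ∷ bs) = count bs

select-++ : ∀ bs vs {cs us} → length bs ≡ length vs →
  select (bs ++ cs) (vs ++ us) ≡ select bs vs ++ select cs us
select-++ [] [] eq = refl
select-++ (b ∷ bs) (v ∷ vs) eq =
  trans (cong (when b v ++_) (select-++ bs vs (suc-injective eq))) (sym (++-assoc (when b v) _ _))

length-select : ∀ bs vs → length bs ≡ length vs → length (select bs vs) ≡ count bs
length-select [] [] eq = refl
length-select (true ∷ bs) (v ∷ vs) eq = cong suc (length-select bs vs (suc-injective eq))
length-select (false ∷ bs) (v ∷ vs) eq = length-select bs vs (suc-injective eq)

count-++ : ∀ bs cs → count (bs ++ cs) ≡ count bs + count cs
count-++ [] cs = refl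
count-++ (true ∷ bs) cs = cong suc (count-++ bs cs)
count-++ (false ∷ bs) cs = count-++ bs cs

Unique-resp-↭ : ∀ {A : Set} {xs ys : List A} → xs ↭ ys → Unique xs → Unique ys
Unique-resp-↭ {A} p = SetoidPermutation.Unique-resp-↭ (setoid A) (↭⇒↭ₛ p)

-- A closed trail in K_k, listed without repeating its first vertex.  It is an
-- Euler tour when bs has k (k - 1) / 2 entries.
record Tour (k : ℕ) (bs : List Bool) : Set where
  constructor mkTour
  field
    vertices    : List ℕ
    sameLength  : length bs ≡ length vertices
    bounded     : All (_< k) vertices
    unique      : Unique (closed vertices)
    proper      : All Proper (closed vertices)
    transversal : Unique (select bs vertices)

closed-∷ʳ : ∀ v us → closed (us ∷ʳ v) ↭ closed (v ∷ us)
closed-∷ʳ v [] = ↭-refl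
closed-∷ʳ v (u ∷ us) = ↭-trans (↭-reflexive eq) (++-comm (walk u (us ++ [ v ])) [ edge v u ])
  where
  eq : walk u ((us ∷ʳ v) ++ [ u ]) ≡ walk u (us ++ [ v ]) ++ [ edge v u ]
  eq = trans (cong (walk u) (++-assoc us [ v ] [ u ])) (walk-++ u us v [ u ])

length-∷ʳ⁻ : ∀ {A B : Set} {x : A} {y : B} xs ys → length (xs ∷ʳ x) ≡ length (ys ∷ʳ y) → length xs ≡ length ys
length-∷ʳ⁻ [] [] eq = refl
length-∷ʳ⁻ [] (y ∷ []) ()
length-∷ʳ⁻ [] (y ∷ y′ ∷ ys) ()
length-∷ʳ⁻ (x ∷ []) [] ()
length-∷ʳ⁻ (x ∷ x′ ∷ xs) [] ()
length-∷ʳ⁻ (x ∷ xs) (y ∷ ys) eq = cong suc (length-∷ʳ⁻ xs ys (suc-injective eq))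

rotate₁ : ∀ {k} b bs → Tour k (bs ∷ʳ b) → Tour k (b ∷ bs)
rotate₁ b bs (mkTour vs len bd un pr tr) with initLast vs
... | [] = case trans (sym (length-++ bs)) len of λ eq → ⊥-elim (1+n≢0 (trans (+-comm 1 (length bs)) eq))
... | us ∷ʳ′ v = mkTour (v ∷ us) (cong suc len′)
  (All-resp-↭ (++-comm us [ v ]) bd)
  (Unique-resp-↭ (closed-∷ʳ v us) un)
  (All-resp-↭ (closed-∷ʳ v us) pr)
  (Unique-resp-↭ (↭-trans (↭-reflexive eq) (++-comm (select bs us) (when b v))) tr)
  where
  len′ = length-∷ʳ⁻ bs us len
  eq : select (bs ∷ʳ b) (us ∷ʳ v) ≡ select bs us ++ when b v
  eq = trans (select-++ bs us len′) (cong (select bs us ++_) (++-identityʳ (when b v)))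

rotate : ∀ {k} xs ys → Tour k (ys ++ xs) → Tour k (xs ++ ys)
rotate [] ys t = subst (Tour _) (++-identityʳ ys) t
rotate (x ∷ xs) ys t =
  rotate₁ x (xs ++ ys) (subst (Tour _) (sym (++-assoc xs ys [ x ]))
    (rotate xs (ys ∷ʳ x) (subst (Tour _) (sym (++-assoc ys [ x ] xs)) t)))

Unique-++⁻ˡ : ∀ {A : Set} (xs : List A) {ys} → Unique (xs ++ ys) → Unique xs
Unique-++⁻ˡ [] un = []
Unique-++⁻ˡ (x ∷ xs) (p ∷ un) = Allₚ.++⁻ˡ xs p ∷ Unique-++⁻ˡ xs un

Unique-++⁻ʳ : ∀ {A : Set} (xs : List A) {ys} → Unique (xs ++ ys) → Unique ys
Unique-++⁻ʳ [] un = un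
Unique-++⁻ʳ (x ∷ xs) (_ ∷ un) = Unique-++⁻ʳ xs un

Unique-++⁺ : ∀ {A : Set} {xs ys : List A} → Unique xs → Unique ys →
  All (λ x → x ∉ ys) xs → Unique (xs ++ ys)
Unique-++⁺ [] uy _ = uy
Unique-++⁺ (p ∷ ux) uy (q ∷ qs) =
  Allₚ.++⁺ p (All.tabulate (λ y∈ eq → q (subst (_∈ _) (sym eq) y∈))) ∷ Unique-++⁺ ux uy qs

extract : ∀ {A : Set} (xs : List A) {zs} → Unique xs → All (_∈ zs) xs → ∃[ rs ] zs ↭ xs ++ rs
extract [] {zs} _ _ = zs , ↭-refl
extract (x ∷ xs) (x∉ ∷ un) (x∈ ∷ xs∈) with ∈-∃++ x∈
... | as , bs , refl with extract xs {as ++ bs} un (All.tabulate λ {y} y∈ →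
        stays (λ y≡x → All.lookup x∉ y∈ (sym y≡x)) (All.lookup xs∈ y∈))
  where
  stays : ∀ {y} → y ≢ x → y ∈ as ++ x ∷ bs → y ∈ as ++ bs
  stays y≢x y∈ with ∈-++⁻ as y∈
  ... | inj₁ p = ∈-++⁺ˡ p
  ... | inj₂ (here eq) = ⊥-elim (y≢x eq)
  ... | inj₂ (there p) = ∈-++⁺ʳ as p
... | rs , p = rs , ↭-trans (shift x as bs) (prep x p)

complement : ∀ {k} xs → Unique xs → All (_< k) xs → ∃[ rs ]
  Unique (xs ++ rs) × All (_< k) (xs ++ rs) × length xs + length rs ≡ k
complement {k} xs un bd with extract xs un (All.map ∈-upTo⁺ bd)
... | rs , p = rs , Unique-resp-↭ p (upTo⁺ k)
             , All-resp-↭ p (All.tabulate ∈-upTo⁻)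
             , trans (sym (length-++ xs)) (trans (sym (↭-length p)) (length-upTo k))

-- Runs of the insertion automaton

-- The new vertices k and k + 1 are the letters false and true.  The edge w₀w₁
-- of a tour of K_k is replaced by a trail w₀ X w₁ w₀ X′ w₁.  In X and X′ letters
-- alternate with old vertices, except for one step between the two letters, and
-- each old vertex other than w₀ and w₁ occurs once, between different letters.
Letter : Set
Letter = Bool

data Marks : Set where
  both none : Marks
  only      : Letter → Marks

data Mark : Bool → Letter → Marks → Marks → Set where
  skip : ∀ {c m} → Mark false c m m
  one  : ∀ {c} → Mark true c both (only (not c))
  two  : ∀ {c} → Mark true c (only c) none

-- Once b b′ x: of two occurrences of an old vertex with bits b and b′ at most
-- one is marked, and x tells whether one is.
data Once : Bool → Bool → Bool → Set where
  never : Once false false false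
  early : Once true false true
  late  : Once false true true

data Stage : Set where
  first  : (β₀ : Bool) → Stage
  second : (t : Letter) (β₁ : Bool) → Stage

-- c is the last letter, u tells whether the step between the letters was made,
-- m holds the letters still to be marked, β₀ and β₁ are the bits of the first
-- occurrences of w₀ and w₁, and d counts the dummies to come: old vertices whose
-- mark is moved here from a later position of the old tour.
data State : Set where
  base         : (β₀ : Bool) (d : ℕ) → State
  letter inner : (s : Stage) (c : Letter) (u : Bool) (m : Marks) (d : ℕ) → State
  exit         : (β₀ β₁ : Bool) (c : Letter) (u : Bool) (m : Marks) (d : ℕ) → State
  entry        : (β₁ : Bool) (c : Letter) (u : Bool) (m : Marks) (d : ℕ) → State
  end          : State

infix 4 _⟨_⟩→_
data _⟨_⟩→_ : State → Bool → State → Set where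
  start  : ∀ {β₀ b m d} → Mark b false both m →
           base β₀ d ⟨ b ⟩→ letter (first β₀) false false m d
  plain  : ∀ {s c u m d} → letter s c u m d ⟨ false ⟩→ inner s c u m d
  dummy  : ∀ {s c u m d} → letter s c u m (suc d) ⟨ true ⟩→ inner s c u m d
  across : ∀ {s c b m m′ d} → Mark b (not c) m m′ →
           letter s c false m d ⟨ b ⟩→ letter s (not c) true m′ d
  back   : ∀ {s c u b m m′ d} → Mark b (not c) m m′ →
           inner s c u m d ⟨ b ⟩→ letter s (not c) u m′ d
  leave  : ∀ {β₀ c u b m d} → letter (first β₀) c u m d ⟨ b ⟩→ exit β₀ b c u m d
  return : ∀ {β₀ β₁ c u b x m d} → Once β₀ b x →
           exit β₀ β₁ c u m d ⟨ b ⟩→ entry β₁ c u m d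
  resume : ∀ {β₁ c u b m m′ d} → Mark b true m m′ →
           entry β₁ c u m d ⟨ b ⟩→ letter (second c β₁) true u m′ d
  finish : ∀ {t β₁ b x} → Once β₁ b x →
           letter (second t β₁) (not t) true none 0 ⟨ b ⟩→ end

infixr 5 _∷_
data Run : State → List Bool → Set where
  []  : Run end []
  _∷_ : ∀ {q q′ b bs} → q ⟨ b ⟩→ q′ → Run q′ bs → Run q (b ∷ bs)

free : ∀ {q bs} → Run q bs → ℕ
free [] = 0
free (plain ∷ r) = suc (free r)
free (start _ ∷ r) = free r
free (dummy ∷ r) = free r
free (across _ ∷ r) = free r
free (back _ ∷ r) = free r
free (leave ∷ r) = free r
free (return _ ∷ r) = free r
free (resume _ ∷ r) = free r
free (finish _ ∷ r) = free r

-- Tells whether w₀ is to be marked in the smaller tour, namely when one of its two occurrences in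
-- the segment is marked; `bit₁` does the same for w₁.
bit₀ : ∀ {q bs} → Run q bs → Bool
bit₀ [] = false
bit₀ (return {x = x} _ ∷ r) = x
bit₀ (plain ∷ r) = bit₀ r
bit₀ (start _ ∷ r) = bit₀ r
bit₀ (dummy ∷ r) = bit₀ r
bit₀ (across _ ∷ r) = bit₀ r
bit₀ (back _ ∷ r) = bit₀ r
bit₀ (leave ∷ r) = bit₀ r
bit₀ (resume _ ∷ r) = false
bit₀ (finish _ ∷ r) = false

bit₁ : ∀ {q bs} → Run q bs → Bool
bit₁ [] = false
bit₁ (finish {x = x} _ ∷ r) = x
bit₁ (return _ ∷ r) = bit₁ r
bit₁ (plain ∷ r) = bit₁ r
bit₁ (start _ ∷ r) = bit₁ r
bit₁ (dummy ∷ r) = bit₁ r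
bit₁ (across _ ∷ r) = bit₁ r
bit₁ (back _ ∷ r) = bit₁ r
bit₁ (leave ∷ r) = bit₁ r
bit₁ (resume _ ∷ r) = bit₁ r

demand : State → ℕ
demand (base β₀ d) = d
demand (letter s c u m d) = d
demand (inner s c u m d) = d
demand (exit β₀ β₁ c u m d) = d
demand (entry β₁ c u m d) = d
demand end = 0

marksOf : State → Marks
marksOf (base β₀ d) = both
marksOf (letter s c u m d) = m
marksOf (inner s c u m d) = m
marksOf (exit β₀ β₁ c u m d) = m
marksOf (entry β₁ c u m d) = m
marksOf end = none

rest : Bool → ℕ → ℕ
rest true n = n
rest false n = suc n

stageLength : Stage → ℕ
stageLength (first _) = 4
stageLength (second _ _) = 1

-- An inner old vertex costs two bits, its own and that of the next letter. Besides these a run has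
-- six steps: `start`, `across`, `leave`, `return`, `resume` and `finish`. `rest` accounts for
-- `across` as long as it has not been made.
overhead : State → ℕ
overhead (base _ _) = 6
overhead (letter s c u m d) = rest u (stageLength s)
overhead (inner s c u m d) = suc (rest u (stageLength s))
overhead (exit _ _ c u m d) = rest u 3
overhead (entry _ c u m d) = rest u 2
overhead end = 0

run-length : ∀ {q bs} (r : Run q bs) → length bs ≡ overhead q + 2 * (free r + demand q)
run-length [] = refl
run-length (plain {s} {u = u} {d = d} ∷ r) rewrite run-length r = lem (rest u (stageLength s)) (free r) d
  where
  lem : ∀ o f d → suc (suc o + 2 * (f + d)) ≡ o + 2 * (suc f + d)
  lem = solve-∀
run-length (dummy {s} {u = u} {d = d} ∷ r) rewrite run-length r = lem (rest u (stageLength s)) (free r) d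
  where
  lem : ∀ o f d → suc (suc o + 2 * (f + d)) ≡ o + 2 * (f + suc d)
  lem = solve-∀
run-length (start _ ∷ r) = cong suc (run-length r)
run-length (across _ ∷ r) = cong suc (run-length r)
run-length (back _ ∷ r) = cong suc (run-length r)
run-length (leave {u = true} ∷ r) = cong suc (run-length r)
run-length (leave {u = false} ∷ r) = cong suc (run-length r)
run-length (return {u = true} _ ∷ r) = cong suc (run-length r)
run-length (return {u = false} _ ∷ r) = cong suc (run-length r)
run-length (resume {u = true} _ ∷ r) = cong suc (run-length r)
run-length (resume {u = false} _ ∷ r) = cong suc (run-length r)
run-length (finish _ ∷ []) = refl

module Insertion (k w₀ w₁ : ℕ) (w₀<k : w₀ < k) (w₁<k : w₁ < k) where

  ℓ : Letter → ℕ
  ℓ false = k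
  ℓ true = suc k

  build : ∀ {q bs} (r : Run q bs) → Vec ℕ (free r) → Vec ℕ (demand q) → List ℕ
  build [] R D = []
  build (start _ ∷ r) R D = k ∷ build r R D
  build (plain ∷ r) (y ∷ R) D = y ∷ build r R D
  build (dummy ∷ r) R (y ∷ D) = y ∷ build r R D
  build (across {c = c} _ ∷ r) R D = ℓ (not c) ∷ build r R D
  build (back {c = c} _ ∷ r) R D = ℓ (not c) ∷ build r R D
  build (leave ∷ r) R D = w₁ ∷ build r R D
  build (return _ ∷ r) R D = w₀ ∷ build r R D
  build (resume _ ∷ r) R D = suc k ∷ build r R D
  build (finish _ ∷ r) R D = w₁ ∷ build r R []

  build-length : ∀ {q bs} (r : Run q bs) R D → length bs ≡ length (build r R D)
  build-length [] R D = refl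
  build-length (start _ ∷ r) R D = cong suc (build-length r R D)
  build-length (plain ∷ r) (y ∷ R) D = cong suc (build-length r R D)
  build-length (dummy ∷ r) R (y ∷ D) = cong suc (build-length r R D)
  build-length (across _ ∷ r) R D = cong suc (build-length r R D)
  build-length (back _ ∷ r) R D = cong suc (build-length r R D)
  build-length (leave ∷ r) R D = cong suc (build-length r R D)
  build-length (return _ ∷ r) R D = cong suc (build-length r R D)
  build-length (resume _ ∷ r) R D = cong suc (build-length r R D)
  build-length (finish _ ∷ r) R D = cong suc (build-length r R [])

  k<2+k : k < 2 + k
  k<2+k = m≤n+m (suc k) 1

  ℓ< : ∀ c → ℓ c < 2 + k
  ℓ< false = k<2+k
  ℓ< true = ≤-refl

  up : ∀ {v} → v < k → v < 2 + k
  up v<k = <-trans v<k k<2+k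

  build-bounded : ∀ {q bs} (r : Run q bs) {R D} → All (_< k) (toList R) → All (_< k) (toList D) →
    All (_< 2 + k) (build r R D)
  build-bounded [] _ _ = []
  build-bounded (start _ ∷ r) aR aD = ℓ< false ∷ build-bounded r aR aD
  build-bounded (plain ∷ r) {y ∷ R} (p ∷ aR) aD = up p ∷ build-bounded r aR aD
  build-bounded (dummy ∷ r) {D = y ∷ D} aR (p ∷ aD) = up p ∷ build-bounded r aR aD
  build-bounded (across {c = c} _ ∷ r) aR aD = ℓ< (not c) ∷ build-bounded r aR aD
  build-bounded (back {c = c} _ ∷ r) aR aD = ℓ< (not c) ∷ build-bounded r aR aD
  build-bounded (leave ∷ r) aR aD = up w₁<k ∷ build-bounded r aR aD
  build-bounded (return _ ∷ r) aR aD = up w₀<k ∷ build-bounded r aR aD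
  build-bounded (resume _ ∷ r) aR aD = ℓ< true ∷ build-bounded r aR aD
  build-bounded (finish _ ∷ r) aR aD = up w₁<k ∷ build-bounded r aR []

  -- A run that has not ended closes with `finish`, hence at w₁, from where the old tour is resumed.
  walk-build : ∀ {q bs} (r : Run q bs) {u} R D zs → q ≢ end →
    walk u (build r R D ++ zs) ≡ walk u (build r R D) ++ walk w₁ zs
  walk-build [] R D zs q≢ = ⊥-elim (q≢ refl)
  walk-build (start _ ∷ r) R D zs _ = cong (_ ∷_) (walk-build r R D zs λ ())
  walk-build (plain ∷ r) (y ∷ R) D zs _ = cong (_ ∷_) (walk-build r R D zs λ ())
  walk-build (dummy ∷ r) R (y ∷ D) zs _ = cong (_ ∷_) (walk-build r R D zs λ ())
  walk-build (across _ ∷ r) R D zs _ = cong (_ ∷_) (walk-build r R D zs λ ())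
  walk-build (back _ ∷ r) R D zs _ = cong (_ ∷_) (walk-build r R D zs λ ())
  walk-build (leave ∷ r) R D zs _ = cong (_ ∷_) (walk-build r R D zs λ ())
  walk-build (return _ ∷ r) R D zs _ = cong (_ ∷_) (walk-build r R D zs λ ())
  walk-build (resume _ ∷ r) R D zs _ = cong (_ ∷_) (walk-build r R D zs λ ())
  walk-build (finish _ ∷ []) R D zs _ = refl

  spoke : ℕ → Letter → Edge
  spoke y c = ℓ c , y

  star : List ℕ → List Edge
  star [] = []
  star (y ∷ ys) = (k , y) ∷ (suc k , y) ∷ star ys

  edge-spoke : ∀ c {y} → y < k → edge (ℓ c) y ≡ spoke y c
  edge-spoke false y<k = edge-> y<k
  edge-spoke true y<k = edge-> (m≤n⇒m≤1+n y<k)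

  edge-spoke′ : ∀ c {y} → y < k → edge y (ℓ c) ≡ spoke y c
  edge-spoke′ c {y} y<k = trans (edge-comm y (ℓ c)) (edge-spoke c y<k)

  bridge : Edge
  bridge = suc k , k

  edge-bridge : ∀ c → edge (ℓ c) (ℓ (not c)) ≡ bridge
  edge-bridge false = trans (edge-comm k (suc k)) (edge-> ≤-refl)
  edge-bridge true = edge-> ≤-refl

  two-spokes : ∀ y c {es} → spoke y c ∷ spoke y (not c) ∷ es ↭ (k , y) ∷ (suc k , y) ∷ es
  two-spokes y false = ↭-refl
  two-spokes y true = _↭_.swap _ _ ↭-refl

  bridges : Bool → List Edge
  bridges true = []
  bridges false = [ bridge ]

  -- The new edges still to be used after reaching v in a given state, apart from
  -- those at the old vertices inside X and X′.
  pendingStage : Stage → List Edge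
  pendingStage (first _) =
    edge w₁ w₀ ∷ spoke w₀ true ∷ (k , w₁) ∷ (suc k , w₁) ∷ []
  pendingStage (second t _) = [ spoke w₁ (not t) ]

  pending : State → ℕ → List Edge
  pending (base _ _) v = bridge ∷ spoke w₀ false ∷ pendingStage (first false)
  pending (letter s c u m d) v = bridges u ++ pendingStage s
  pending (inner s c u m d) v = spoke v (not c) ∷ bridges u ++ pendingStage s
  pending (exit _ _ c u m d) v = bridges u ++ edge w₁ w₀ ∷ spoke w₀ true ∷ spoke w₁ (not c) ∷ []
  pending (entry _ c u m d) v = bridges u ++ spoke w₀ true ∷ spoke w₁ (not c) ∷ []
  pending end v = []

  At : State → ℕ → Set
  At (base _ _) v = v ≡ w₀
  At (letter s c u m d) v = v ≡ ℓ c
  At (inner s c u m d) v = v < k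
  At (exit _ _ c u m d) v = v ≡ w₁
  At (entry _ c u m d) v = v ≡ w₀
  At end v = v ≡ w₁

  open Solver (++-commutativeMonoid {A = Edge}) using (solve; _⊕_; _⊜_) public

  -- An invariant along the run. At `base` it says that the segment uses the bridge, both spokes of
  -- every old vertex met, and the old edge, each exactly once.
  build-edges : ∀ {q bs} (r : Run q bs) {R D v} → At q v →
    All (_< k) (toList R) → All (_< k) (toList D) →
    walk v (build r R D) ↭ star (toList D) ++ star (toList R) ++ pending q v
  build-edges [] {[]} {[]} at aR aD = ↭-refl
  build-edges (start _ ∷ r) {R} {D} refl aR aD
    rewrite edge-spoke′ false w₀<k =
    ↭-trans (prep _ (build-edges r refl aR aD))
      (solve 5 (λ D R e a p → e ⊕ D ⊕ R ⊕ a ⊕ p ⊜ D ⊕ R ⊕ a ⊕ e ⊕ p) ↭-refl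
        (star (toList D)) (star (toList R)) [ spoke w₀ false ] [ bridge ] (pendingStage (first false)))
  build-edges (plain {s} {c} {u} ∷ r) {y ∷ R} {D} refl (p ∷ aR) aD
    rewrite edge-spoke c p =
    ↭-trans (prep _ (build-edges r p aR aD))
    (↭-trans (solve 5 (λ D R e f p → e ⊕ D ⊕ R ⊕ f ⊕ p ⊜ D ⊕ (e ⊕ f) ⊕ R ⊕ p) ↭-refl
        (star (toList D)) (star (toList R)) [ spoke y c ] [ spoke y (not c) ] (bridges u ++ pendingStage s))
      (++⁺ˡ (star (toList D)) (two-spokes y c)))
  build-edges (dummy {s} {c} {u} ∷ r) {R} {y ∷ D} refl aR (p ∷ aD)
    rewrite edge-spoke c p =
    ↭-trans (prep _ (build-edges r p aR aD))
    (↭-trans (solve 5 (λ D R e f p → e ⊕ D ⊕ R ⊕ f ⊕ p ⊜ (e ⊕ f) ⊕ D ⊕ R ⊕ p) ↭-refl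
        (star (toList D)) (star (toList R)) [ spoke y c ] [ spoke y (not c) ] (bridges u ++ pendingStage s))
      (two-spokes y c))
  build-edges (across {s} {c} _ ∷ r) {R} {D} refl aR aD
    rewrite edge-bridge c =
    ↭-trans (prep _ (build-edges r refl aR aD))
      (solve 4 (λ D R e p → e ⊕ D ⊕ R ⊕ p ⊜ D ⊕ R ⊕ e ⊕ p) ↭-refl
        (star (toList D)) (star (toList R)) [ bridge ] (pendingStage s))
  build-edges (back {s} {c} {u} _ ∷ r) {R} {D} {v} at aR aD
    rewrite edge-spoke′ (not c) at =
    ↭-trans (prep _ (build-edges r refl aR aD))
      (solve 4 (λ D R e p → e ⊕ D ⊕ R ⊕ p ⊜ D ⊕ R ⊕ e ⊕ p) ↭-refl
        (star (toList D)) (star (toList R)) [ spoke v (not c) ] (bridges u ++ pendingStage s))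
  build-edges (leave {c = c} {u} ∷ r) {R} {D} refl aR aD
    rewrite edge-spoke c w₁<k =
    ↭-trans (prep _ (build-edges r refl aR aD))
    (↭-trans (solve 7 (λ D R e u f g h → e ⊕ D ⊕ R ⊕ u ⊕ f ⊕ g ⊕ h ⊜ (D ⊕ R ⊕ u ⊕ f ⊕ g) ⊕ e ⊕ h) ↭-refl
        (star (toList D)) (star (toList R)) [ spoke w₁ c ] (bridges u) [ edge w₁ w₀ ] [ spoke w₀ true ] [ spoke w₁ (not c) ])
    (↭-trans (++⁺ˡ (star (toList D) ++ star (toList R) ++ bridges u ++ edge w₁ w₀ ∷ spoke w₀ true ∷ []) (two-spokes w₁ c))
      (solve 6 (λ D R u f g e → (D ⊕ R ⊕ u ⊕ f ⊕ g) ⊕ e ⊜ D ⊕ R ⊕ u ⊕ f ⊕ g ⊕ e) ↭-refl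
        (star (toList D)) (star (toList R)) (bridges u) [ edge w₁ w₀ ] [ spoke w₀ true ] ((k , w₁) ∷ (suc k , w₁) ∷ []))))
  build-edges (return {c = c} {u} _ ∷ r) {R} {D} refl aR aD =
    ↭-trans (prep _ (build-edges r refl aR aD))
      (solve 5 (λ D R e u p → e ⊕ D ⊕ R ⊕ u ⊕ p ⊜ D ⊕ R ⊕ u ⊕ e ⊕ p) ↭-refl
        (star (toList D)) (star (toList R)) [ edge w₁ w₀ ] (bridges u) (spoke w₀ true ∷ spoke w₁ (not c) ∷ []))
  build-edges (resume {c = c} {u} _ ∷ r) {R} {D} refl aR aD
    rewrite edge-spoke′ true w₀<k =
    ↭-trans (prep _ (build-edges r refl aR aD))
      (solve 5 (λ D R e u p → e ⊕ D ⊕ R ⊕ u ⊕ p ⊜ D ⊕ R ⊕ u ⊕ e ⊕ p) ↭-refl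
        (star (toList D)) (star (toList R)) [ spoke w₀ true ] (bridges u) [ spoke w₁ (not c) ])
  build-edges (finish {t} _ ∷ []) {[]} {[]} refl aR aD
    rewrite edge-spoke (not t) w₁<k = ↭-refl

  lettersOf : Marks → List ℕ
  lettersOf both = k ∷ suc k ∷ []
  lettersOf (only c) = [ ℓ c ]
  lettersOf none = []

  -- The marked occurrences of w₀ and w₁ whose second occurrence is still to come.
  carried : State → List ℕ
  carried (base β₀ d) = when β₀ w₀
  carried (letter (first β₀) c u m d) = when β₀ w₀
  carried (letter (second t β₁) c u m d) = when β₁ w₁
  carried (inner (first β₀) c u m d) = when β₀ w₀
  carried (inner (second t β₁) c u m d) = when β₁ w₁
  carried (exit β₀ β₁ c u m d) = when β₀ w₀ ++ when β₁ w₁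
  carried (entry β₁ c u m d) = when β₁ w₁
  carried end = []

  module ℕSolver = Solver (++-commutativeMonoid {A = ℕ})

  mark-letters : ∀ {b c m m′} → Mark b c m m′ → when b (ℓ c) ++ lettersOf m′ ↭ lettersOf m
  mark-letters skip = ↭-refl
  mark-letters {c = false} one = ↭-refl
  mark-letters {c = true} one = _↭_.swap _ _ ↭-refl
  mark-letters two = ↭-refl

  once-when : ∀ {β b x} v → Once β b x → when β v ++ when b v ≡ when x v
  once-when v never = refl
  once-when v early = refl
  once-when v late = refl

  private
    push : ∀ c w s D m m′ h → c ++ s ↭ D ++ m′ ++ h → w ++ m′ ↭ m → c ++ w ++ s ↭ D ++ m ++ h
    push c w s D m m′ h p q =
      ↭-trans (ℕSolver.solve 3 (λ c w s → c ⊕′ w ⊕′ s ⊜′ w ⊕′ c ⊕′ s) ↭-refl c w s)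
      (↭-trans (++⁺ˡ w p)
      (↭-trans (ℕSolver.solve 4 (λ w D m h → w ⊕′ D ⊕′ m ⊕′ h ⊜′ D ⊕′ (w ⊕′ m) ⊕′ h) ↭-refl w D m′ h)
        (++⁺ˡ D (++⁺ʳ h q))))
      where open ℕSolver renaming (_⊕_ to _⊕′_; _⊜_ to _⊜′_)

  -- Both occurrences of w₀ precede `resume`, so nothing about w₀ remains to be decided in the
  -- second stage.
  bit₀-second : ∀ {t β₁ c u m d bs} (r : Run (letter (second t β₁) c u m d) bs) → bit₀ r ≡ false
  bit₀-second′ : ∀ {t β₁ c u m d bs} (r : Run (inner (second t β₁) c u m d) bs) → bit₀ r ≡ false
  bit₀-second (plain ∷ r) = bit₀-second′ r
  bit₀-second (dummy ∷ r) = bit₀-second′ r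
  bit₀-second (across _ ∷ r) = bit₀-second r
  bit₀-second (finish _ ∷ r) = refl
  bit₀-second′ (back _ ∷ r) = bit₀-second r

  -- The matching invariant for marks. At `base` it says that the segment marks both new vertices,
  -- the dummies, and w₀ and w₁ as prescribed by `bit₀` and `bit₁`; hence the smaller tour gains
  -- only the two new vertices as marked vertices.
  build-marks : ∀ {q bs} (r : Run q bs) R D →
    carried q ++ select bs (build r R D) ↭
    toList D ++ lettersOf (marksOf q) ++ when (bit₀ r) w₀ ++ when (bit₁ r) w₁
  build-marks [] R [] = ↭-refl
  build-marks (start {β₀} {b} μ ∷ r) R D =
    push (when β₀ w₀) (when b k) _ (toList D) _ _ _ (build-marks r R D) (mark-letters μ)
  build-marks (plain {first _} ∷ r) (y ∷ R) D = build-marks r R D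
  build-marks (plain {second _ _} ∷ r) (y ∷ R) D = build-marks r R D
  build-marks (dummy {first β} ∷ r) R (y ∷ D) =
    ↭-trans (shift y (when β w₀) _) (prep y (build-marks r R D))
  build-marks (dummy {second _ β} ∷ r) R (y ∷ D) =
    ↭-trans (shift y (when β w₁) _) (prep y (build-marks r R D))
  build-marks (across {first β} {c} {b} μ ∷ r) R D =
    push (when β w₀) (when b (ℓ (not c))) _ (toList D) _ _ _ (build-marks r R D) (mark-letters μ)
  build-marks (across {second _ β} {c} {b} μ ∷ r) R D =
    push (when β w₁) (when b (ℓ (not c))) _ (toList D) _ _ _ (build-marks r R D) (mark-letters μ)
  build-marks (back {first β} {c} {b = b} μ ∷ r) R D =
    push (when β w₀) (when b (ℓ (not c))) _ (toList D) _ _ _ (build-marks r R D) (mark-letters μ)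
  build-marks (back {second _ β} {c} {b = b} μ ∷ r) R D =
    push (when β w₁) (when b (ℓ (not c))) _ (toList D) _ _ _ (build-marks r R D) (mark-letters μ)
  build-marks (leave {β₀} {b = b} ∷ r) R D =
    ↭-trans (↭-reflexive (sym (++-assoc (when β₀ w₀) (when b w₁) _))) (build-marks r R D)
  -- Exposing `resume` makes `bit₀ r` reduce to `false`, so the mark of w₀ is contributed by `x`
  -- alone.
  build-marks {bs = _ ∷ bs} (return {β₀} {β₁} {b = b} {x} {m} o ∷ r@(resume _ ∷ _)) R D =
    ↭-trans (ℕSolver.solve 4 (λ a b c s → (a ⊕′ b) ⊕′ c ⊕′ s ⊜′ (a ⊕′ c) ⊕′ b ⊕′ s) ↭-refl
              (when β₀ w₀) (when β₁ w₁) (when b w₀) (select bs (build r R D)))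
    (↭-trans (++⁺ (↭-reflexive (once-when w₀ o)) (build-marks r R D))
      (ℕSolver.solve 4 (λ x D m h → x ⊕′ D ⊕′ m ⊕′ h ⊜′ D ⊕′ m ⊕′ x ⊕′ h) ↭-refl
        (when x w₀) (toList D) (lettersOf m) (when (bit₁ r) w₁)))
    where open ℕSolver renaming (_⊕_ to _⊕′_; _⊜_ to _⊜′_)
  build-marks {bs = _ ∷ bs} (resume {β₁} {b = b} {m′ = m′} μ ∷ r) R D =
    push (when β₁ w₁) (when b (suc k)) (select bs (build r R D)) (toList D) _ _ (when (bit₁ r) w₁)
      (subst (λ x → when β₁ w₁ ++ select bs (build r R D) ↭
                    toList D ++ lettersOf m′ ++ when x w₀ ++ when (bit₁ r) w₁)
        (bit₀-second r) (build-marks r R D))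
      (mark-letters μ)
  build-marks (finish {b = b} o ∷ []) [] [] =
    ↭-reflexive (trans (cong (when _ w₁ ++_) (++-identityʳ (when b w₁))) (once-when w₁ o))

-- Inserting two vertices into a tour

-- A tour w₀ w₁ ts determines vertices other than w₀ and w₁ at the two ends of
-- ts; only these serve as dummies.
data Raise : ℕ → List Bool → List Bool → Set where
  keep : ∀ {T} → Raise 0 T T
  head : ∀ {T} → Raise 1 (false ∷ T) (true ∷ T)
  last : ∀ {T} → Raise 1 (T ++ [ false ]) (T ++ [ true ])
  head-last : ∀ {T} → Raise 2 (false ∷ T ++ [ false ]) (true ∷ T ++ [ true ])

raise-length : ∀ {d T T′} → Raise d T T′ → length T ≡ length T′
raise-length keep = refl
raise-length head = refl
raise-length (last {T}) = trans (length-++ T) (sym (length-++ T))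
raise-length (head-last {T}) = cong suc (trans (length-++ T) (sym (length-++ T)))

walk-bounded : ∀ {k u} vs → u < k → All (_< k) vs → All (λ e → proj₁ e < k) (walk u vs)
walk-bounded [] u<k [] = []
walk-bounded (v ∷ vs) u<k (v<k ∷ p) = ⊔-lub u<k v<k ∷ walk-bounded vs v<k p

closed-bounded : ∀ {k} vs → All (_< k) vs → All (λ e → proj₁ e < k) (closed vs)
closed-bounded [] [] = []
closed-bounded (v ∷ vs) (p ∷ ps) = walk-bounded (vs ++ [ v ]) p (Allₚ.++⁺ ps (p ∷ []))

select-All : ∀ {P : ℕ → Set} bs {vs} → All P vs → All P (select bs vs)
select-All [] _ = []
select-All (b ∷ bs) [] = []
select-All (true ∷ bs) (p ∷ ps) = p ∷ select-All bs ps
select-All (false ∷ bs) (p ∷ ps) = select-All bs ps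

toVec : ∀ {n} (xs : List ℕ) → length xs ≡ n → Σ (Vec ℕ n) λ v → toList v ≡ xs
toVec xs refl = fromList xs , toList∘fromList xs

snoc : ∀ {T : List Bool} {b} (ts : List ℕ) → length (T ++ [ b ]) ≡ length ts →
  ∃[ zs ] ∃[ l ] ts ≡ zs ∷ʳ l × length T ≡ length zs
snoc {T} ts len with initLast ts
... | [] = ⊥-elim (1+n≢0 (trans (+-comm 1 (length T)) (trans (sym (length-++ T)) len)))
... | zs ∷ʳ′ l = zs , l , refl , length-∷ʳ⁻ T zs len

raise-last : ∀ T zs l → length T ≡ length zs →
  l ∷ select (T ++ [ false ]) (zs ∷ʳ l) ↭ select (T ++ [ true ]) (zs ∷ʳ l)
raise-last T zs l len
  rewrite select-++ T zs {[ false ]} {[ l ]} len | select-++ T zs {[ true ]} {[ l ]} len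
        | ++-identityʳ (select T zs) = ++-comm [ l ] (select T zs)

module _ {k w₀ w₁ : ℕ} where

  Fresh : ℕ → Set
  Fresh y = y < k × y ≢ w₀ × y ≢ w₁

  -- If z were w₁ the tour would contain a loop, and if z were w₀ it would use the edge w₀w₁ twice.
  -- The same argument at the closing edge gives `last-fresh`.
  second-fresh : ∀ {z zs} → All (_< k) (w₀ ∷ w₁ ∷ z ∷ zs) → Unique (closed (w₀ ∷ w₁ ∷ z ∷ zs)) →
    All Proper (closed (w₀ ∷ w₁ ∷ z ∷ zs)) → Fresh z
  second-fresh {z} (_ ∷ _ ∷ z<k ∷ _) ((e≢ ∷ _) ∷ _) (_ ∷ pr ∷ _) =
    z<k , (λ { refl → e≢ (edge-comm z w₁) }) , λ { refl → proper⇒≢ pr refl }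

  last-fresh : ∀ zs {l} → All (_< k) (w₀ ∷ w₁ ∷ zs ∷ʳ l) → Unique (closed (w₀ ∷ w₁ ∷ zs ∷ʳ l)) →
    All Proper (closed (w₀ ∷ w₁ ∷ zs ∷ʳ l)) → Fresh l
  last-fresh zs {l} (_ ∷ _ ∷ bd) (e≢ ∷ _) (_ ∷ pr) =
    All.lookup bd (∈-++⁺ʳ zs (here refl)) ,
    (λ { refl → proper⇒≢ {l} (All.lookup pr closing) refl }) ,
    (λ { refl → All.lookup e≢ closing (edge-comm w₀ l) })
    where
    closing : edge l w₀ ∈ walk w₁ ((zs ∷ʳ l) ++ [ w₀ ])
    closing = subst (λ vs → edge l w₀ ∈ walk w₁ vs) (sym (++-assoc zs [ l ] [ w₀ ]))
      (subst (edge l w₀ ∈_) (sym (walk-++ w₁ zs l [ w₀ ])) (∈-++⁺ʳ (walk w₁ (zs ++ [ l ])) (here refl)))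

  dummies : ∀ {d T T′} ts → Raise d T T′ → length T′ ≡ length ts → All (_< k) (w₀ ∷ w₁ ∷ ts) →
    Unique (closed (w₀ ∷ w₁ ∷ ts)) → All Proper (closed (w₀ ∷ w₁ ∷ ts)) →
    Σ (Vec ℕ d) λ D → (toList D ++ select T ts ↭ select T′ ts) × All Fresh (toList D)
  dummies ts keep len bd un pr = [] , ↭-refl , []
  dummies (z ∷ ts) head len bd un pr = z ∷ [] , ↭-refl , second-fresh bd un pr ∷ []
  dummies ts (last {T}) len bd un pr with snoc {T} ts len
  ... | zs , l , refl , len′ = l ∷ [] , raise-last T zs l len′ , last-fresh zs bd un pr ∷ []
  dummies (z ∷ ts) (head-last {T}) len bd un pr with snoc {T} ts (suc-injective len)
  ... | zs , l , refl , len′ = z ∷ l ∷ [] , prep z (raise-last T zs l len′)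
                             , second-fresh bd un pr ∷ last-fresh (z ∷ zs) bd un pr ∷ []

-- The length condition makes the segment meet all k old vertices: w₀, w₁, the d dummies, and as
-- many others as the run has plain steps. These others can be supplied in any order, so
-- `complement` provides them.
insertion : ∀ {k β d core T T′} (r : Run (base β d) core) → Raise d T T′ →
  suc (length core) ≡ 2 * k + 3 → Tour k (bit₀ r ∷ bit₁ r ∷ T′) → Tour (2 + k) ((β ∷ core) ++ T)
insertion _ _ _ (mkTour [] () _ _ _ _)
insertion _ _ _ (mkTour (_ ∷ []) () _ _ _ _)
insertion {k} {β} {d} {core} {T} {T′} r raise len
  (mkTour (w₀ ∷ w₁ ∷ ts) sl bd@(w₀<k ∷ w₁<k ∷ ts<k) un pr tr) = result
  where
  open Insertion k w₀ w₁ w₀<k w₁<k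
  lenT = suc-injective (suc-injective sl)
  chosen = dummies {k} ts raise lenT bd un pr
  D = proj₁ chosen
  D↭ = proj₁ (proj₂ chosen)
  D-fresh = proj₂ (proj₂ chosen)

  split-unique : Unique (when (bit₀ r) w₀ ++ when (bit₁ r) w₁ ++ select T′ ts)
  split-unique = tr

  -- All dummies are marked vertices of the smaller tour under `T′`, so its transversality keeps
  -- them apart.
  D-unique : Unique (toList D)
  D-unique = Unique-++⁻ˡ (toList D) (Unique-resp-↭ (↭-sym D↭)
    (Unique-++⁻ʳ (when (bit₁ r) w₁) (Unique-++⁻ʳ (when (bit₀ r) w₀) split-unique)))

  w₀≢w₁ : w₀ ≢ w₁
  w₀≢w₁ = proper⇒≢ (All.head pr)

  used : List ℕ
  used = w₀ ∷ w₁ ∷ toList D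

  remaining = complement used
    ((w₀≢w₁ ∷ All.map (λ f → proj₁ (proj₂ f) ∘ sym) D-fresh)
      ∷ All.map (λ f → proj₂ (proj₂ f) ∘ sym) D-fresh ∷ D-unique)
    (w₀<k ∷ w₁<k ∷ All.map proj₁ D-fresh)
  rs = proj₁ remaining
  all-unique = proj₁ (proj₂ remaining)
  all<k = proj₁ (proj₂ (proj₂ remaining))

  supply : length rs ≡ free r
  supply = +-cancelˡ-≡ (2 + d) _ _ (trans (cong (λ x → 2 + x + length rs) (sym (length-toList D)))
    (trans (proj₂ (proj₂ (proj₂ remaining))) (sym (*-cancelˡ-≡ _ k 2 (+-cancelʳ-≡ 3 _ _
      (trans (arith d (free r)) (trans (cong suc (sym (run-length r))) len)))))))
    where
    arith : ∀ d f → 2 * (2 + d + f) + 3 ≡ suc (6 + 2 * (f + d))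
    arith = solve-∀

  R = proj₁ (toVec rs supply)
  R≡ : toList R ≡ rs
  R≡ = proj₂ (toVec rs supply)

  inner<k : All (_< k) (toList D ++ toList R)
  inner<k = subst (λ xs → All (_< k) (toList D ++ xs)) (sym R≡) (All.tail (All.tail all<k))

  D<k = Allₚ.++⁻ˡ (toList D) inner<k
  R<k = Allₚ.++⁻ʳ (toList D) inner<k

  new : List ℕ
  new = build r R D

  ys : List ℕ
  ys = w₀ ∷ w₁ ∷ toList D ++ toList R

  star-++ : ∀ as bs → star (as ++ bs) ≡ star as ++ star bs
  star-++ [] bs = refl
  star-++ (a ∷ as) bs = cong (λ es → (k , a) ∷ (suc k , a) ∷ es) (star-++ as bs)

  edges : closed (w₀ ∷ new ++ ts) ↭ bridge ∷ star ys ++ closed (w₀ ∷ w₁ ∷ ts)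
  edges = ↭-trans (↭-reflexive (trans (cong (walk w₀) (++-assoc new ts [ w₀ ]))
                    (walk-build r R D (ts ++ [ w₀ ]) λ ())))
    (↭-trans (++⁺ʳ (walk w₁ (ts ++ [ w₀ ])) (build-edges r {R} {D} refl R<k D<k))
    (↭-trans (solve 8 (λ D R b s e t p q → (D ⊕ R ⊕ b ⊕ s ⊕ e ⊕ t ⊕ p) ⊕ q ⊜ b ⊕ (s ⊕ t ⊕ p ⊕ D ⊕ R) ⊕ e ⊕ q) ↭-refl
        (star (toList D)) (star (toList R)) [ bridge ] [ spoke w₀ false ] [ edge w₁ w₀ ] [ spoke w₀ true ]
        ((k , w₁) ∷ (suc k , w₁) ∷ []) (walk w₁ (ts ++ [ w₀ ])))
      (↭-reflexive (cong₂ (λ es e → bridge ∷ (k , w₀) ∷ (suc k , w₀) ∷ (k , w₁) ∷ (suc k , w₁) ∷ es ++ e ∷ walk w₁ (ts ++ [ w₀ ]))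
        (sym (star-++ (toList D) (toList R))) (edge-comm w₁ w₀)))))

  k≤star : ∀ xs → All (_< k) xs → All (λ e → k ≤ proj₁ e × proj₂ e ∈ xs × proj₂ e < k) (star xs)
  k≤star [] [] = []
  k≤star (x ∷ xs) (p ∷ ps) = (≤-refl , here refl , p) ∷ (n≤1+n k , here refl , p)
    ∷ All.map (λ (a , b , c) → a , there b , c) (k≤star xs ps)

  star-unique : ∀ xs → Unique xs → All (_< k) xs → Unique (star xs)
  star-unique [] [] [] = []
  star-unique (x ∷ xs) (x∉ ∷ un) (p ∷ ps) =
    ((λ eq → 1+n≢n (sym (cong proj₁ eq))) ∷ away k) ∷ away (suc k) ∷ star-unique xs un ps
    where
    away : ∀ a → All ((a , x) ≢_) (star xs)
    away a = All.map (λ (_ , m , _) eq → All.lookup x∉ m (cong proj₂ eq)) (k≤star xs ps)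

  ys-unique : Unique ys
  ys-unique = subst (λ xs → Unique (w₀ ∷ w₁ ∷ toList D ++ xs)) (sym R≡) all-unique

  ys<k : All (_< k) ys
  ys<k = w₀<k ∷ w₁<k ∷ inner<k

  old<k = closed-bounded (w₀ ∷ w₁ ∷ ts) bd

  edges-unique : Unique (bridge ∷ star ys ++ closed (w₀ ∷ w₁ ∷ ts))
  edges-unique =
    Allₚ.++⁺ (All.map (λ (_ , _ , y<k) eq → <-irrefl (sym (cong proj₂ eq)) y<k) (k≤star ys ys<k))
             (All.map (λ e<k eq → <⇒≱ e<k (subst (k ≤_) (cong proj₁ eq) (n≤1+n k))) old<k)
    ∷ Unique-++⁺ (star-unique ys ys-unique ys<k) un
        (All.map (λ (k≤ , _) e∈ → <⇒≱ (All.lookup old<k e∈) k≤) (k≤star ys ys<k))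

  edges-proper : All Proper (bridge ∷ star ys ++ closed (w₀ ∷ w₁ ∷ ts))
  edges-proper = 1+n≢n ∷ Allₚ.++⁺
    (All.map (λ (k≤ , _ , y<k) eq → <⇒≱ y<k (subst (k ≤_) eq k≤)) (k≤star ys ys<k)) pr

  marks : select ((β ∷ core) ++ T) (w₀ ∷ new ++ ts) ↭
          k ∷ suc k ∷ select (bit₀ r ∷ bit₁ r ∷ T′) (w₀ ∷ w₁ ∷ ts)
  marks = ↭-trans (↭-reflexive (trans (cong (when β w₀ ++_) (select-++ core new (build-length r R D)))
                    (sym (++-assoc (when β w₀) (select core new) (select T ts)))))
    (↭-trans (++⁺ʳ (select T ts) (build-marks r R D))
    (↭-trans (ℕSolver.solve 5 (λ D a b c s → (D ⊕′ a ⊕′ b ⊕′ c) ⊕′ s ⊜′ a ⊕′ b ⊕′ c ⊕′ D ⊕′ s) ↭-refl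
        (toList D) (k ∷ suc k ∷ []) (when (bit₀ r) w₀) (when (bit₁ r) w₁) (select T ts))
      (++⁺ˡ (k ∷ suc k ∷ when (bit₀ r) w₀) (++⁺ˡ (when (bit₁ r) w₁) D↭))))
    where open ℕSolver renaming (_⊕_ to _⊕′_; _⊜_ to _⊜′_)

  marked<k = select-All (bit₀ r ∷ bit₁ r ∷ T′) bd

  result : Tour (2 + k) ((β ∷ core) ++ T)
  result = mkTour (w₀ ∷ new ++ ts)
    (cong suc (trans (length-++ core) (trans (cong₂ _+_ (build-length r R D) T-length) (sym (length-++ new)))))
    (up w₀<k ∷ Allₚ.++⁺ (build-bounded r R<k D<k) (All.map up ts<k))
    (Unique-resp-↭ (↭-sym edges) edges-unique)
    (All-resp-↭ (↭-sym edges) edges-proper)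
    (Unique-resp-↭ (↭-sym marks)
      (((λ eq → 1+n≢n (sym eq)) ∷ All.map (λ p eq → <-irrefl (sym eq) p) marked<k)
      ∷ All.map (λ p eq → <-irrefl (sym eq) (m<n⇒m<1+n p)) marked<k
      ∷ tr))
    where
    T-length : length T ≡ length ts
    T-length = trans (raise-length raise) lenT

-- Searching for a run inside a window

-- A window has two bits outside the insertion.  The number of those to come is
-- r, the last bit passed is x, and g tells whether the first bit after the
-- insertion is raised.  The steps marked ⁺ raise a bit.
data Window : Set where
  before : (r : ℕ) (x : Bool) → Window
  inside : (r : ℕ) (g : Bool) (q : State) → Window

⌊_⌋ : Bool → ℕ
⌊ false ⌋ = 0
⌊ true ⌋ = 1

infix 4 _[_]⇒_
data _[_]⇒_ : Window → Bool → Window → Set where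
  skip     : ∀ {r x b} → before (suc r) x [ b ]⇒ before r b
  enter    : ∀ {r x b} g → before r x [ b ]⇒ inside r g (base b ⌊ g ⌋)
  enter⁺   : ∀ {r b} g → before r false [ b ]⇒ inside r g (base b (suc ⌊ g ⌋))
  go       : ∀ {r g b q q′} → q ⟨ b ⟩→ q′ → inside r g q [ b ]⇒ inside r g q′
  after    : ∀ {r b} → inside (suc r) false end [ b ]⇒ inside r false end
  after⁺   : ∀ {r} → inside (suc r) true end [ false ]⇒ inside r false end

data Path : Window → List Bool → Set where
  []  : Path (inside 0 false end) []
  _∷_ : ∀ {q q′ b bs} → q [ b ]⇒ q′ → Path q′ bs → Path q (b ∷ bs)

-- In continuation-passing style the search backtracks as soon as the caller
-- rejects a path.
module _ {A : Set} where

  infixr 2 _orElse_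
  _orElse_ : Maybe A → Maybe A → Maybe A
  just x orElse y = just x
  nothing orElse y = y

  onMark : ∀ b c m → (∀ {m′} → Mark b c m m′ → Maybe A) → Maybe A
  onMark false c m f = f skip
  onMark true c both f = f one
  onMark true false (only false) f = f two
  onMark true true (only true) f = f two
  onMark true _ _ f = nothing

  onOnce : ∀ β b → (∀ {x} → Once β b x → Maybe A) → Maybe A
  onOnce false false f = f never
  onOnce true false f = f early
  onOnce false true f = f late
  onOnce true true f = nothing

  atEnd : ∀ r g bs → (Path (inside r g end) bs → Maybe A) → Maybe A
  atEnd zero false [] f = f []
  atEnd (suc r) false (b ∷ bs) f = atEnd r false bs (λ p → f (after ∷ p))
  atEnd (suc r) true (false ∷ bs) f = atEnd r false bs (λ p → f (after⁺ ∷ p))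
  atEnd _ _ _ f = nothing

  atLetter : ∀ {r g} s c u m d bs → (Path (inside r g (letter s c u m d)) bs → Maybe A) → Maybe A
  atInner  : ∀ {r g} s c u m d bs → (Path (inside r g (inner s c u m d)) bs → Maybe A) → Maybe A

  goAside : ∀ {r g} s c u m d b bs → (Path (inside r g (letter s c u m d)) (b ∷ bs) → Maybe A) → Maybe A
  goAside s c u m d false bs f = atInner s c u m d bs (λ p → f (go plain ∷ p))
  goAside s c u m (suc d) true bs f = atInner s c u m d bs (λ p → f (go dummy ∷ p))
  goAside s c u m zero true bs f = nothing

  goAcross : ∀ {r g} s c u m d b bs → (Path (inside r g (letter s c u m d)) (b ∷ bs) → Maybe A) → Maybe A
  goAcross s c true m d b bs f = nothing
  goAcross s c false m d b bs f =
    onMark b (not c) m λ μ → atLetter s (not c) true _ d bs (λ p → f (go (across μ) ∷ p))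

  goAlong : ∀ {r g} s c u m d b bs → (Path (inside r g (letter s c u m d)) (b ∷ bs) → Maybe A) → Maybe A
  goAlong (first β₀) c u m d b (b′ ∷ b″ ∷ bs) f =
    onOnce β₀ b′ λ o → onMark b″ true m λ μ → atLetter (second c b) true u _ d bs
      (λ p → f (go leave ∷ go (return o) ∷ go (resume μ) ∷ p))
  goAlong {r} {g} (second false β₁) true true none zero b bs f =
    onOnce β₁ b λ o → atEnd r g bs (λ p → f (go (finish o) ∷ p))
  goAlong {r} {g} (second true β₁) false true none zero b bs f =
    onOnce β₁ b λ o → atEnd r g bs (λ p → f (go (finish o) ∷ p))
  goAlong _ _ _ _ _ _ _ f = nothing

  atLetter s c u m d [] f = nothing
  atLetter s c u m d (b ∷ bs) f =
    goAside s c u m d b bs f orElse goAcross s c u m d b bs f orElse goAlong s c u m d b bs f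

  atInner s c u m d [] f = nothing
  atInner s c u m d (b ∷ bs) f =
    onMark b (not c) m λ μ → atLetter s (not c) u _ d bs (λ p → f (go (back μ) ∷ p))

  atBase : ∀ {r g} β₀ d bs → (Path (inside r g (base β₀ d)) bs → Maybe A) → Maybe A
  atBase β₀ d [] f = nothing
  atBase β₀ d (b ∷ bs) f =
    onMark b false both λ μ → atLetter (first β₀) false false _ d bs (λ p → f (go (start μ) ∷ p))

  goEnter : ∀ r x b bs → (Path (before r x) (b ∷ bs) → Maybe A) → Maybe A
  goEnter zero x b bs f = atBase b 0 bs (λ p → f (enter false ∷ p))
  goEnter (suc r) x b bs f =
    atBase b 1 bs (λ p → f (enter true ∷ p)) orElse atBase b 0 bs (λ p → f (enter false ∷ p))

  goEnter⁺ : ∀ r x b bs → (Path (before r x) (b ∷ bs) → Maybe A) → Maybe A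
  goEnter⁺ r true b bs f = nothing
  goEnter⁺ zero false b bs f = atBase b 1 bs (λ p → f (enter⁺ false ∷ p))
  goEnter⁺ (suc r) false b bs f =
    atBase b 2 bs (λ p → f (enter⁺ true ∷ p)) orElse atBase b 1 bs (λ p → f (enter⁺ false ∷ p))

  search : ∀ r x bs → (Path (before r x) bs → Maybe A) → Maybe A
  search r x [] f = nothing
  search zero x (b ∷ bs) f = goEnter⁺ zero x b bs f orElse goEnter zero x b bs f
  search (suc r) x (b ∷ bs) f =
    search r b bs (λ p → f (skip ∷ p)) orElse goEnter⁺ (suc r) x b bs f orElse goEnter (suc r) x b bs f

-- The initial `true` rules out `enter⁺` before any bit has been passed, when there is no bit to
-- raise.
opening : Window
opening = before 2 true

zeros : ℕ → List Bool → List Bool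
zeros zero bs = bs
zeros (suc n) bs = false ∷ zeros n bs

word : ℕ → ℕ → ℕ → ℕ → ℕ → List Bool
word a b c d e = zeros a (true ∷ zeros b (true ∷ zeros c (true ∷ zeros d (true ∷ zeros e []))))

-- The gaps between marks can be lengthened by 4 (see grow), so only gaps below 8
-- matter; without a gap of at least 4 none has been shortened, and then the
-- total is at least 11.
admissible : ℕ → ℕ → ℕ → ℕ → ℕ → Bool
admissible a b c d e =
  (1 ≤ᵇ a) ∧ ((a + b + c + d + e) % 4 ≡ᵇ 3) ∧ ((11 ≤ᵇ a + b + c + d + e) ∨ (4 ≤ᵇ a ⊔ b ⊔ c ⊔ d ⊔ e))

solvable : ℕ → ℕ → ℕ → ℕ → ℕ → Bool
solvable a b c d e with admissible a b c d e
... | false = true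
... | true = is-just (search 2 true (word a b c d e) just)

below : ℕ → (ℕ → Bool) → Bool
below zero P = true
below (suc n) P = P n ∧ below n P

below-sound : ∀ n P → T (below n P) → ∀ {i} → i < n → T (P i)
below-sound (suc n) P t {i} i<1+n with Equivalence.to (T-∧ {P n}) t | i ≟ n
... | p , _ | yes refl = p
... | _ , q | no i≢n = below-sound n P q (≤∧≢⇒< (s≤s⁻¹ i<1+n) i≢n)

below⁵ : ℕ → (ℕ → ℕ → ℕ → ℕ → ℕ → Bool) → Bool
below⁵ n P = below n λ a → below n λ b → below n λ c → below n λ d → below n (P a b c d)

below⁵-sound : ∀ n P → below⁵ n P ≡ true → ∀ {a b c d e} → a < n → b < n → c < n → d < n → e < n → T (P a b c d e)
below⁵-sound n P eq {a} {b} {c} {d} a< b< c< d< e< =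
  below-sound n (P a b c d) (below-sound n (λ d → below n (P a b c d))
    (below-sound n (λ c → below n λ d → below n (P a b c d))
      (below-sound n (λ b → below n λ c → below n λ d → below n (P a b c d))
        (below-sound n (λ a → below n λ b → below n λ c → below n λ d → below n (P a b c d)) (subst T (sym eq) tt) a<) b<) c<) d<) e<

abstract
  table : below⁵ 8 solvable ≡ true
  table = refl

table-sound : ∀ {a b c d e} → a < 8 → b < 8 → c < 8 → d < 8 → e < 8 → T (solvable a b c d e)
table-sound = below⁵-sound 8 solvable table

-- The smaller tour left by a path

-- Two unmarked inner vertices lead from the letter `c` to the other one and back, so the state
-- recurs after four bits. The case split only makes `not (not c)` reduce.
detour : ∀ {r g s c u m d bs} → Path (inside r g (letter s c u m d)) bs →
  Path (inside r g (letter s c u m d)) (zeros 4 bs)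
detour {c = false} p = go plain ∷ go (back skip) ∷ go plain ∷ go (back skip) ∷ p
detour {c = true} p = go plain ∷ go (back skip) ∷ go plain ∷ go (back skip) ∷ p

room : Window → ℕ
room (before r _) = r
room (inside r _ _) = r

-- Four unmarked bits are enough to reach a state at a letter, where a detour fits. The slowest case
-- is two bits skipped, then w₀, then the first letter. After the end of the run at most two bits
-- remain, so four cannot be read there.
grow : ∀ {q bs} → room q ≤ 2 → Path q (zeros 4 bs) → Path q (zeros 8 bs)
grow {inside r g (letter s c u m d)} le p = detour p
grow {inside r g (base β₀ d)} le (go (start skip) ∷ p) = go (start skip) ∷ detour p
grow {inside r g (inner s c u m d)} le (go (back skip) ∷ p) = go (back skip) ∷ detour p
grow {inside r g (exit β₀ β₁ c u m d)} le (go (return o) ∷ go (resume skip) ∷ p) =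
  go (return o) ∷ go (resume skip) ∷ detour p
grow {inside r g (entry β₁ c u m d)} le (go (resume skip) ∷ p) = go (resume skip) ∷ detour p
grow le (enter g ∷ go (start skip) ∷ p) = enter g ∷ go (start skip) ∷ detour p
grow le (enter⁺ g ∷ go (start skip) ∷ p) = enter⁺ g ∷ go (start skip) ∷ detour p
grow le (skip ∷ enter g ∷ go (start skip) ∷ p) = skip ∷ enter g ∷ go (start skip) ∷ detour p
grow le (skip ∷ enter⁺ g ∷ go (start skip) ∷ p) = skip ∷ enter⁺ g ∷ go (start skip) ∷ detour p
grow le (skip ∷ skip ∷ enter g ∷ go (start skip) ∷ p) = skip ∷ skip ∷ enter g ∷ go (start skip) ∷ detour p
grow le (skip ∷ skip ∷ enter⁺ g ∷ go (start skip) ∷ p) = skip ∷ skip ∷ enter⁺ g ∷ go (start skip) ∷ detour p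
grow (s≤s (s≤s ())) (skip ∷ skip ∷ skip ∷ p)
grow (s≤s (s≤s ())) (after ∷ after ∷ after ∷ p)
grow (s≤s (s≤s ())) (after⁺ ∷ after ∷ after ∷ p)

room-step : ∀ {q b q′} → q [ b ]⇒ q′ → room q′ ≤ room q
room-step (skip {r}) = n≤1+n r
room-step (enter g) = ≤-refl
room-step (enter⁺ g) = ≤-refl
room-step (go s) = ≤-refl
room-step (after {r}) = n≤1+n r
room-step (after⁺ {r}) = n≤1+n r

stretch : ∀ {q} us {bs} → room q ≤ 2 → Path q (us ++ zeros 4 bs) → Path q (us ++ zeros 8 bs)
stretch [] le p = grow le p
stretch (u ∷ us) le (s ∷ p) = s ∷ stretch us (≤-trans (room-step s) le) p

-- The bits of the word split as pre ++ core ++ post, where the first bit of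
-- post and the last bit of pre can be raised for the dummies of the run.
record Split (ws : List Bool) : Set where
  constructor mkSplit
  field
    {first-bit} : Bool
    {dummies#}  : ℕ
    {core}      : List Bool
    pre post    : List Bool
    run         : Run (base first-bit dummies#) core
    raised      : ∀ mid → ∃ (Raise dummies# (post ++ mid ++ pre))
    shape       : ws ≡ pre ++ (first-bit ∷ core) ++ post
    margins     : length pre + length post ≡ 2

reassoc : ∀ {A : Set} (xs ys zs : List A) {us} → (xs ++ ys ++ zs) ++ us ≡ xs ++ ys ++ zs ++ us
reassoc xs ys zs = trans (++-assoc xs (ys ++ zs) _) (cong (xs ++_) (++-assoc ys zs _))

module _ {ws} (s : Split ws) (rest : List Bool) where
  open Split s

  innerBits : List Bool
  innerBits = bit₀ run ∷ bit₁ run ∷ proj₁ (raised rest)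

  split-insertion : ∀ {k} → length ws ≡ 2 * k + 5 → Tour k innerBits → Tour (2 + k) (ws ++ rest)
  split-insertion {k} len t = subst (Tour (2 + k)) eq
    (rotate pre ((first-bit ∷ core) ++ post ++ rest)
      (subst (Tour (2 + k)) eq′ (insertion run (proj₂ (raised rest)) len′ t)))
    where
    eq : pre ++ (first-bit ∷ core) ++ post ++ rest ≡ ws ++ rest
    eq = trans (cong (pre ++_) (sym (++-assoc (first-bit ∷ core) post rest)))
      (trans (sym (++-assoc pre _ rest)) (cong (_++ rest) (sym shape)))
    eq′ : (first-bit ∷ core) ++ post ++ rest ++ pre ≡ ((first-bit ∷ core) ++ post ++ rest) ++ pre
    eq′ = sym (trans (++-assoc (first-bit ∷ core) (post ++ rest) pre)
      (cong ((first-bit ∷ core) ++_) (++-assoc post rest pre)))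
    len′ : suc (length core) ≡ 2 * k + 3
    len′ = +-cancelˡ-≡ 2 _ _ (trans (cong (_+ suc (length core)) (sym margins))
      (trans (arith (length pre) (suc (length core)) (length post))
      (trans (sym (trans (cong length shape) (trans (length-++ pre) (cong (length pre +_) (length-++ (first-bit ∷ core))))))
      (trans len (+-comm′ k)))))
      where
      arith : ∀ a b c → (a + c) + b ≡ a + (b + c)
      arith = solve-∀
      +-comm′ : ∀ k → 2 * k + 5 ≡ 2 + (2 * k + 3)
      +-comm′ = solve-∀

  private
    raise-count : ∀ {d T T′} → Raise d T T′ → count T′ ≡ d + count T
    raise-count keep = refl
    raise-count head = refl
    raise-count (last {T}) = trans (count-++ T _) (trans (+-comm _ 1) (cong suc
      (sym (trans (count-++ T _) (+-identityʳ _)))))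
    raise-count (head-last {T}) = cong suc (trans (count-++ T _) (trans (+-comm _ 1) (cong suc
      (sym (trans (count-++ T _) (+-identityʳ _))))))

  innerBits-length : length innerBits ≡ 4 + length rest
  innerBits-length = cong (2 +_) (trans (sym (raise-length (proj₂ (raised rest))))
    (trans (length-++ post) (trans (cong (length post +_) (length-++ rest))
    (trans (arith (length post) (length rest) (length pre)) (cong (_+ length rest) margins)))))
    where
    arith : ∀ a b c → a + (b + c) ≡ (c + a) + b
    arith = solve-∀

  innerBits-count : count (ws ++ rest) ≡ 2 + count innerBits
  innerBits-count = begin
    count (ws ++ rest)
      ≡⟨ trans (count-++ ws rest) (cong (λ bs → count bs + count rest) shape) ⟩
    count (pre ++ (first-bit ∷ core) ++ post) + count rest
      ≡⟨ cong (_+ count rest) (trans (count-++ pre _) (cong (count pre +_) (count-++ (first-bit ∷ core) post))) ⟩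
    count pre + (count (first-bit ∷ core) + count post) + count rest
      ≡⟨ cong (λ c → count pre + (c + count post) + count rest) core-count ⟩
    count pre + (dummies# + (2 + (⌊ bit₀ run ⌋ + ⌊ bit₁ run ⌋)) + count post) + count rest
      ≡⟨ arith (count pre) dummies# ⌊ bit₀ run ⌋ ⌊ bit₁ run ⌋ (count post) (count rest) ⟩
    2 + (⌊ bit₀ run ⌋ + (⌊ bit₁ run ⌋ + (dummies# + (count post + (count rest + count pre)))))
      ≡⟨ cong (λ c → 2 + (⌊ bit₀ run ⌋ + (⌊ bit₁ run ⌋ + c))) (sym (trans (raise-count (proj₂ (raised rest)))
           (cong (dummies# +_) (trans (count-++ post _) (cong (count post +_) (count-++ rest pre)))))) ⟩
    2 + (⌊ bit₀ run ⌋ + (⌊ bit₁ run ⌋ + count (proj₁ (raised rest))))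
      ≡⟨ cong (2 +_) (sym (trans (count-∷ (bit₀ run) _) (cong (⌊ bit₀ run ⌋ +_) (count-∷ (bit₁ run) _)))) ⟩
    2 + count innerBits ∎
    where
    open ≡-Reasoning
    arith : ∀ p d x y q r → p + (d + (2 + (x + y)) + q) + r ≡ 2 + (x + (y + (d + (q + (r + p)))))
    arith = solve-∀
    count-∷ : ∀ b bs → count (b ∷ bs) ≡ ⌊ b ⌋ + count bs
    count-∷ true bs = refl
    count-∷ false bs = refl
    length-when : ∀ b v → length (when b v) ≡ ⌊ b ⌋
    length-when true v = refl
    length-when false v = refl
    -- The number of marks does not depend on the vertices chosen.
    core-count : count (first-bit ∷ core) ≡ dummies# + (2 + (⌊ bit₀ run ⌋ + ⌊ bit₁ run ⌋))
    core-count = begin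
      count (first-bit ∷ core)
        ≡⟨ count-∷ first-bit core ⟩
      ⌊ first-bit ⌋ + count core
        ≡⟨ sym (cong₂ _+_ (length-when first-bit 0) (length-select core (build run R D) (build-length run R D))) ⟩
      length (when first-bit 0) + length (select core (build run R D))
        ≡⟨ sym (length-++ (when first-bit 0)) ⟩
      length (when first-bit 0 ++ select core (build run R D))
        ≡⟨ ↭-length (build-marks run R D) ⟩
      length (Vec.toList D ++ 1 ∷ 2 ∷ when (bit₀ run) 0 ++ when (bit₁ run) 0)
        ≡⟨ length-++ (Vec.toList D) ⟩
      length (Vec.toList D) + (2 + length (when (bit₀ run) 0 ++ when (bit₁ run) 0))
        ≡⟨ cong₂ (λ a b → a + (2 + b)) (length-toList D) (trans (length-++ (when (bit₀ run) 0))
             (cong₂ _+_ (length-when (bit₀ run) 0) (length-when (bit₁ run) 0))) ⟩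
      dummies# + (2 + (⌊ bit₀ run ⌋ + ⌊ bit₁ run ⌋)) ∎
      where
      open Insertion 1 0 0 z<s z<s
      R = Vec.replicate (free run) 0
      D = Vec.replicate dummies# 0

-- The bits of the smaller tour, computed directly from a path.
shadow₀ shadow₁ : ∀ {r g q bs} → Path (inside r g q) bs → Bool
shadow₀ (go (start _) ∷ p) = shadow₀ p
shadow₀ (go plain ∷ p) = shadow₀ p
shadow₀ (go dummy ∷ p) = shadow₀ p
shadow₀ (go (across _) ∷ p) = shadow₀ p
shadow₀ (go (back _) ∷ p) = shadow₀ p
shadow₀ (go leave ∷ p) = shadow₀ p
shadow₀ (go (return {x = x} _) ∷ p) = x
shadow₀ _ = false
shadow₁ (go (start _) ∷ p) = shadow₁ p
shadow₁ (go plain ∷ p) = shadow₁ p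
shadow₁ (go dummy ∷ p) = shadow₁ p
shadow₁ (go (across _) ∷ p) = shadow₁ p
shadow₁ (go (back _) ∷ p) = shadow₁ p
shadow₁ (go leave ∷ p) = shadow₁ p
shadow₁ (go (return _) ∷ p) = shadow₁ p
shadow₁ (go (resume _) ∷ p) = shadow₁ p
shadow₁ (go (finish {x = x} _) ∷ p) = x
shadow₁ _ = false

shadowEnd : ∀ {r g q bs} → Path (inside r g q) bs → List Bool
shadowEnd [] = []
shadowEnd (go s ∷ p) = shadowEnd p
shadowEnd (after {b = b} ∷ p) = b ∷ shadowEnd p
shadowEnd (after⁺ ∷ p) = true ∷ shadowEnd p

raiseLast : List Bool → List Bool
raiseLast [] = []
raiseLast (b ∷ []) = [ true ]
raiseLast (b ∷ bs@(_ ∷ _)) = b ∷ raiseLast bs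

raiseLast-∷ʳ : ∀ bs b → raiseLast (bs ++ [ b ]) ≡ bs ++ [ true ]
raiseLast-∷ʳ [] b = refl
raiseLast-∷ʳ (c ∷ []) b = refl
raiseLast-∷ʳ (c ∷ bs@(_ ∷ _)) b = cong (c ∷_) (raiseLast-∷ʳ bs b)

-- The smaller tour is listed from w₀ onwards, so the bits `pre` passed before the insertion move
-- behind `rest`, where the last of them belongs to the vertex preceding w₀.
shadow : ∀ {r x bs} → Path (before r x) bs → List Bool → List Bool → List Bool
shadow (skip {b = b} ∷ p) pre rest = shadow p (pre ∷ʳ b) rest
shadow (enter g ∷ p) pre rest = shadow₀ p ∷ shadow₁ p ∷ shadowEnd p ++ rest ++ pre
shadow (enter⁺ g ∷ p) pre rest = shadow₀ p ∷ shadow₁ p ∷ shadowEnd p ++ rest ++ raiseLast pre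

Headed : Bool → List Bool → List Bool → Set
Headed false bs bs′ = bs′ ≡ bs
Headed true bs bs′ = ∃[ cs ] bs ≡ false ∷ cs × bs′ ≡ true ∷ cs

splitEnd : ∀ {r g bs} (p : Path (inside r g end) bs) → length bs ≡ r × Headed g bs (shadowEnd p)
splitEnd [] = refl , refl
splitEnd (after ∷ p) with splitEnd p
... | len , eq = cong suc len , cong (_ ∷_) eq
splitEnd (after⁺ ∷ p) with splitEnd p
... | len , eq = cong suc len , _ , refl , cong (true ∷_) eq

record CoreSplit {r g q bs} (p : Path (inside r g q) bs) : Set where
  constructor coreSplit
  field
    core post : List Bool
    run       : Run q core
    shape     : bs ≡ core ++ post
    first≡    : bit₀ run ≡ shadow₀ p
    second≡   : bit₁ run ≡ shadow₁ p
    margin    : length post ≡ r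
    headed    : Headed g post (shadowEnd p)

splitCore : ∀ {r g q bs} (p : Path (inside r g q) bs) → CoreSplit p
splitCore {q = end} p = let len , hd = splitEnd p in coreSplit [] _ [] refl (sym (done₀ p)) (sym (done₁ p)) len hd
  where
  done₀ : ∀ {r g bs} (p : Path (inside r g end) bs) → shadow₀ p ≡ false
  done₀ [] = refl
  done₀ (after ∷ p) = refl
  done₀ (after⁺ ∷ p) = refl
  done₁ : ∀ {r g bs} (p : Path (inside r g end) bs) → shadow₁ p ≡ false
  done₁ [] = refl
  done₁ (after ∷ p) = refl
  done₁ (after⁺ ∷ p) = refl
splitCore (go (start μ) ∷ p) with splitCore p
... | coreSplit _ post r refl e₀ e₁ len hd = coreSplit _ post (start μ ∷ r) refl e₀ e₁ len hd
splitCore (go plain ∷ p) with splitCore p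
... | coreSplit _ post r refl e₀ e₁ len hd = coreSplit _ post (plain ∷ r) refl e₀ e₁ len hd
splitCore (go dummy ∷ p) with splitCore p
... | coreSplit _ post r refl e₀ e₁ len hd = coreSplit _ post (dummy ∷ r) refl e₀ e₁ len hd
splitCore (go (across μ) ∷ p) with splitCore p
... | coreSplit _ post r refl e₀ e₁ len hd = coreSplit _ post (across μ ∷ r) refl e₀ e₁ len hd
splitCore (go (back μ) ∷ p) with splitCore p
... | coreSplit _ post r refl e₀ e₁ len hd = coreSplit _ post (back μ ∷ r) refl e₀ e₁ len hd
splitCore (go leave ∷ p) with splitCore p
... | coreSplit _ post r refl e₀ e₁ len hd = coreSplit _ post (leave ∷ r) refl e₀ e₁ len hd
splitCore (go (return o) ∷ p) with splitCore p
... | coreSplit _ post r refl e₀ e₁ len hd = coreSplit _ post (return o ∷ r) refl refl e₁ len hd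
splitCore (go (resume μ) ∷ p) with splitCore p
... | coreSplit _ post r refl e₀ e₁ len hd = coreSplit _ post (resume μ ∷ r) refl refl e₁ len hd
splitCore (go (finish o) ∷ p) with splitCore p
... | coreSplit _ post r refl e₀ e₁ len hd = coreSplit _ post (finish o ∷ r) refl refl refl len hd


SplitOf : ∀ {r x bs} → Path (before r x) bs → List Bool → List Bool → Set
SplitOf p pre ws = Σ (Split ws) λ s → ∀ rest → innerBits s rest ≡ shadow p pre rest

-- The condition on `x` records that a bit `false` last passed is the end of `pre`; this is the bit
-- that `enter⁺` raises.
splitAfter : ∀ {r x bs} pre → length pre + r ≡ 2 → (x ≡ false → ∃[ cs ] pre ≡ cs ++ [ false ]) →
  (p : Path (before r x) bs) → SplitOf p pre (pre ++ bs)
splitAfter {suc r} {x} pre len tail (skip {b = b} ∷ p) =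
  subst (SplitOf {x = x} (skip ∷ p) pre) (++-assoc pre [ b ] _)
    (splitAfter (pre ∷ʳ b) (trans (cong (_+ r) (length-++ pre)) (trans (+-assoc (length pre) 1 r) len))
      (λ { refl → pre , refl }) p)
splitAfter pre len tail (enter false ∷ p) with splitCore p
... | coreSplit core post r refl e₀ e₁ refl hd =
  mkSplit pre post r (λ mid → _ , keep) refl len ,
  λ rest → cong₂ _∷_ e₀ (cong₂ _∷_ e₁ (cong (_++ rest ++ pre) (sym hd)))
splitAfter pre len tail (enter true ∷ p) with splitCore p
... | coreSplit core post r refl e₀ e₁ refl (cs , refl , hd) =
  mkSplit pre post r (λ mid → _ , head) refl len ,
  λ rest → cong₂ _∷_ e₀ (cong₂ _∷_ e₁ (cong (_++ rest ++ pre) (sym hd)))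
splitAfter pre len tail (enter⁺ g ∷ p) with tail refl
splitAfter pre len tail (enter⁺ false ∷ p) | cs , refl with splitCore p
... | coreSplit core post r refl e₀ e₁ refl hd =
  mkSplit pre post r
    (λ mid → post ++ mid ++ cs ++ [ true ] ,
      subst₂ (Raise 1) (reassoc post mid cs) (reassoc post mid cs) (last {post ++ mid ++ cs}))
    refl len ,
  λ rest → cong₂ _∷_ e₀ (cong₂ _∷_ e₁ (cong₂ (λ as bs → as ++ rest ++ bs) (sym hd) (sym (raiseLast-∷ʳ cs false))))
splitAfter pre len tail (enter⁺ true ∷ p) | cs , refl with splitCore p
... | coreSplit core post r refl e₀ e₁ refl (ps , refl , hd) =
  mkSplit pre post r
    (λ mid → true ∷ ps ++ mid ++ cs ++ [ true ] ,
      subst₂ (λ S T → Raise 2 (false ∷ S) (true ∷ T)) (reassoc ps mid cs) (reassoc ps mid cs) (head-last {ps ++ mid ++ cs}))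
    refl len ,
  λ rest → cong₂ _∷_ e₀ (cong₂ _∷_ e₁ (cong₂ (λ as bs → as ++ rest ++ bs) (sym hd) (sym (raiseLast-∷ʳ cs false))))

shadowOf : ∀ {ws} → Path opening ws → List Bool → List Bool
shadowOf p rest = shadow p [] rest

module _ {ws} (p : Path opening ws) (rest : List Bool) where

  private
    s : SplitOf p [] ws
    s = splitAfter [] refl (λ ()) p

  shadow-tour : ∀ {k} → length ws ≡ 2 * k + 5 → Tour k (shadowOf p rest) → Tour (2 + k) (ws ++ rest)
  shadow-tour len t = split-insertion (proj₁ s) rest len (subst (Tour _) (sym (proj₂ s rest)) t)

  shadow-length : length (shadowOf p rest) ≡ 4 + length rest
  shadow-length = trans (cong length (sym (proj₂ s rest))) (innerBits-length (proj₁ s) rest)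

  shadow-count : count (ws ++ rest) ≡ 2 + count (shadowOf p rest)
  shadow-count = trans (innerBits-count (proj₁ s) rest) (cong (2 +_) (cong count (proj₂ s rest)))

-- Windows with four marks

from-just : ∀ {A : Set} (x : Maybe A) → T (is-just x) → A
from-just (just x) _ = x

solvable-sound : ∀ a b c d e → T (admissible a b c d e) → T (solvable a b c d e) → Path opening (word a b c d e)
solvable-sound a b c d e adm t with admissible a b c d e
... | true = from-just _ t

table-path : ∀ {a b c d e} → a < 8 → b < 8 → c < 8 → d < 8 → e < 8 → T (admissible a b c d e) →
  Path opening (word a b c d e)
table-path {a} {b} {c} {d} {e} a< b< c< d< e< adm =
  solvable-sound a b c d e adm (table-sound {a} {b} {c} {d} {e} a< b< c< d< e<)

-- Subtracts 4 as long as the argument is at least 8.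
red : ℕ → ℕ
red (suc (suc (suc (suc m@(suc (suc (suc (suc _)))))))) = red m
red n = n

red-ind : ∀ (P : ℕ → ℕ → Set) → (∀ {n} → n < 8 → P n n) → (∀ m r → P (4 + m) r → P (8 + m) r) → ∀ n → P n (red n)
red-ind P small step 0 = small (m≤m+n 1 7)
red-ind P small step 1 = small (m≤m+n 2 6)
red-ind P small step 2 = small (m≤m+n 3 5)
red-ind P small step 3 = small (m≤m+n 4 4)
red-ind P small step 4 = small (m≤m+n 5 3)
red-ind P small step 5 = small (m≤m+n 6 2)
red-ind P small step 6 = small (m≤m+n 7 1)
red-ind P small step 7 = small (m≤m+n 8 0)
red-ind P small step (suc (suc (suc (suc m@(suc (suc (suc (suc n)))))))) = step n (red m) (red-ind P small step m)

red<8 : ∀ n → red n < 8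
red<8 = red-ind (λ _ r → r < 8) id (λ _ _ → id)

red-mod : ∀ n → ∃[ q ] n ≡ red n + q * 4
red-mod = red-ind (λ n r → ∃[ q ] n ≡ r + q * 4) (λ {n} _ → 0 , sym (+-identityʳ n))
  (λ m r (q , eq) → suc q , trans (cong (4 +_) eq) (arith r q))
  where
  arith : ∀ r q → 4 + (r + q * 4) ≡ r + (4 + q * 4)
  arith = solve-∀

red-small : ∀ n → red n < 4 → red n ≡ n
red-small = red-ind (λ n r → r < 4 → r ≡ n) (λ _ _ → refl)
  (λ m r h r<4 → case h r<4 of λ eq → ⊥-elim (<⇒≱ r<4 (subst (4 ≤_) (sym eq) (m≤m+n 4 m))))

red-pos : ∀ n → 1 ≤ n → 1 ≤ red n
red-pos = red-ind (λ n r → 1 ≤ n → 1 ≤ r) (λ _ → id) (λ m r h _ → h (s≤s z≤n))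

unred : ∀ (us : List Bool) n {bs} → Path opening (us ++ zeros (red n) bs) → Path opening (us ++ zeros n bs)
unred us n {bs} = red-ind (λ n r → Path opening (us ++ zeros r bs) → Path opening (us ++ zeros n bs))
  (λ _ → id) (λ m r h p → stretch us ≤-refl (h p)) n

zeros-++ : ∀ n bs cs → zeros n bs ++ cs ≡ zeros n (bs ++ cs)
zeros-++ zero bs cs = refl
zeros-++ (suc n) bs cs = cong (false ∷_) (zeros-++ n bs cs)

unred-word : ∀ a b c d e → Path opening (word (red a) (red b) (red c) (red d) (red e)) → Path opening (word a b c d e)
unred-word a b c d e p =
  cast₄ e (unred (p₄ b c d) e (cast₄′ (red e)
  (cast₃ d (unred (p₃ b c) d (cast₃′ (red d)
  (cast₂ c (unred (p₂ b) c (cast₂′ (red c)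
  (cast₁ b (unred p₁ b (cast₁′ (red b) (unred [] a p))))))))))))
  where
  p₁ : List Bool
  p₁ = zeros a [ true ]
  p₂ : ℕ → List Bool
  p₂ b = zeros a (true ∷ zeros b [ true ])
  p₃ : ℕ → ℕ → List Bool
  p₃ b c = zeros a (true ∷ zeros b (true ∷ zeros c [ true ]))
  p₄ : ℕ → ℕ → ℕ → List Bool
  p₄ b c d = zeros a (true ∷ zeros b (true ∷ zeros c (true ∷ zeros d [ true ])))
  eq₁ : ∀ bs → p₁ ++ bs ≡ zeros a (true ∷ bs)
  eq₁ bs = zeros-++ a _ _
  eq₂ : ∀ b bs → p₂ b ++ bs ≡ zeros a (true ∷ zeros b (true ∷ bs))
  eq₂ b bs = trans (zeros-++ a _ _) (cong (λ x → zeros a (true ∷ x)) (zeros-++ b _ _))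
  eq₃ : ∀ b c bs → p₃ b c ++ bs ≡ zeros a (true ∷ zeros b (true ∷ zeros c (true ∷ bs)))
  eq₃ b c bs = trans (zeros-++ a _ _) (cong (λ x → zeros a (true ∷ x))
    (trans (zeros-++ b _ _) (cong (λ x → zeros b (true ∷ x)) (zeros-++ c _ _))))
  eq₄ : ∀ b c d bs → p₄ b c d ++ bs ≡ zeros a (true ∷ zeros b (true ∷ zeros c (true ∷ zeros d (true ∷ bs))))
  eq₄ b c d bs = trans (zeros-++ a _ _) (cong (λ x → zeros a (true ∷ x))
    (trans (zeros-++ b _ _) (cong (λ x → zeros b (true ∷ x))
      (trans (zeros-++ c _ _) (cong (λ x → zeros c (true ∷ x)) (zeros-++ d _ _))))))
  cast₁ : ∀ n {bs} → Path opening (p₁ ++ zeros n bs) → Path opening (zeros a (true ∷ zeros n bs))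
  cast₁ n = subst (Path opening) (eq₁ _)
  cast₁′ : ∀ n {bs} → Path opening (zeros a (true ∷ zeros n bs)) → Path opening (p₁ ++ zeros n bs)
  cast₁′ n = subst (Path opening) (sym (eq₁ _))
  cast₂ : ∀ n {b bs} → Path opening (p₂ b ++ zeros n bs) → Path opening _
  cast₂ n {b} = subst (Path opening) (eq₂ b _)
  cast₂′ : ∀ n {b bs} → Path opening (zeros a (true ∷ zeros b (true ∷ zeros n bs))) → Path opening (p₂ b ++ zeros n bs)
  cast₂′ n {b} = subst (Path opening) (sym (eq₂ b _))
  cast₃ : ∀ n {b c bs} → Path opening (p₃ b c ++ zeros n bs) → Path opening _
  cast₃ n {b} {c} = subst (Path opening) (eq₃ b c _)
  cast₃′ : ∀ n {b c bs} → Path opening (zeros a (true ∷ zeros b (true ∷ zeros c (true ∷ zeros n bs)))) → Path opening (p₃ b c ++ zeros n bs)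
  cast₃′ n {b} {c} = subst (Path opening) (sym (eq₃ b c _))
  cast₄ : ∀ n {b c d bs} → Path opening (p₄ b c d ++ zeros n bs) → Path opening _
  cast₄ n {b} {c} {d} = subst (Path opening) (eq₄ b c d _)
  cast₄′ : ∀ n {b c d bs} → Path opening (zeros a (true ∷ zeros b (true ∷ zeros c (true ∷ zeros d (true ∷ zeros n bs))))) → Path opening (p₄ b c d ++ zeros n bs)
  cast₄′ n {b} {c} {d} = subst (Path opening) (sym (eq₄ b c d _))

word-path : ∀ a b c d e → 1 ≤ a → (a + b + c + d + e) % 4 ≡ 3 → 11 ≤ a + b + c + d + e →
  Path opening (word a b c d e)
word-path a b c d e 1≤a mod big = unred-word a b c d e
  (table-path (red<8 a) (red<8 b) (red<8 c) (red<8 d) (red<8 e)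
    (Equivalence.from T-∧ (≤⇒≤ᵇ (red-pos a 1≤a) , Equivalence.from T-∧ (≡⇒≡ᵇ _ _ mod′ , Equivalence.from T-∨ large))))
  where
  a′ = red a ; b′ = red b ; c′ = red c ; d′ = red d ; e′ = red e
  qa = red-mod a ; qb = red-mod b ; qc = red-mod c ; qd = red-mod d ; qe = red-mod e
  sum-eq : ∃[ r ] a + b + c + d + e ≡ (a′ + b′ + c′ + d′ + e′) + r * 4
  sum-eq = add (add (add (add qa qb) qc) qd) qe
    where
    arith : ∀ x y p q → (x + p * 4) + (y + q * 4) ≡ (x + y) + (p + q) * 4
    arith = solve-∀
    add : ∀ {m n x y} ((p , _) : ∃[ p ] m ≡ x + p * 4) ((q , _) : ∃[ q ] n ≡ y + q * 4) → ∃[ r ] m + n ≡ (x + y) + r * 4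
    add {x = x} {y} (p , refl) (q , refl) = p + q , arith x y p q
  mod′ : (a′ + b′ + c′ + d′ + e′) % 4 ≡ 3
  mod′ = trans (sym ([m+kn]%n≡m%n (a′ + b′ + c′ + d′ + e′) (proj₁ sum-eq) 4))
    (trans (cong (_% 4) (sym (proj₂ sum-eq))) mod)
  max = a′ ⊔ b′ ⊔ c′ ⊔ d′ ⊔ e′
  large : T (11 ≤ᵇ a′ + b′ + c′ + d′ + e′) ⊎ T (4 ≤ᵇ max)
  large with 4 ≤? max
  ... | yes p = inj₂ (≤⇒≤ᵇ p)
  ... | no p = inj₁ (≤⇒≤ᵇ (subst (11 ≤_) (sym all-eq) big))
    where
    e< = ≰⇒> p
    le-e : e′ < 4
    le-e = m⊔n<o⇒n<o (a′ ⊔ b′ ⊔ c′ ⊔ d′) e′ e<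
    d< = m⊔n<o⇒m<o (a′ ⊔ b′ ⊔ c′ ⊔ d′) e′ e<
    le-d = m⊔n<o⇒n<o (a′ ⊔ b′ ⊔ c′) d′ d<
    c< = m⊔n<o⇒m<o (a′ ⊔ b′ ⊔ c′) d′ d<
    le-c = m⊔n<o⇒n<o (a′ ⊔ b′) c′ c<
    b< = m⊔n<o⇒m<o (a′ ⊔ b′) c′ c<
    all-eq : a′ + b′ + c′ + d′ + e′ ≡ a + b + c + d + e
    all-eq = cong₂ _+_ (cong₂ _+_ (cong₂ _+_ (cong₂ _+_ (red-small a (m⊔n<o⇒m<o a′ b′ b<))
      (red-small b (m⊔n<o⇒n<o a′ b′ b<))) (red-small c le-c)) (red-small d le-d)) (red-small e le-e)

leading : ∀ bs n → count bs ≡ suc n → ∃[ a ] ∃[ cs ] bs ≡ zeros a (true ∷ cs) × count cs ≡ n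
leading (true ∷ bs) n eq = 0 , bs , refl , suc-injective eq
leading (false ∷ bs) n eq with leading bs n eq
... | a , cs , refl , eq′ = suc a , cs , refl , eq′

no-marks : ∀ bs → count bs ≡ 0 → bs ≡ zeros (length bs) []
no-marks [] eq = refl
no-marks (false ∷ bs) eq = cong (false ∷_) (no-marks bs eq)

length-zeros : ∀ n bs → length (zeros n bs) ≡ n + length bs
length-zeros zero bs = refl
length-zeros (suc n) bs = cong suc (length-zeros n bs)

four-marks : ∀ bs → count bs ≡ 4 → ∃[ a ] ∃[ b ] ∃[ c ] ∃[ d ] ∃[ e ]
  bs ≡ word a b c d e × length bs ≡ 4 + (a + b + c + d + e)
four-marks bs eq with leading bs 3 eq
... | a , bs₁ , refl , eq₁ with leading bs₁ 2 eq₁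
... | b , bs₂ , refl , eq₂ with leading bs₂ 1 eq₂
... | c , bs₃ , refl , eq₃ with leading bs₃ 0 eq₃
... | d , bs₄ , refl , eq₄ = a , b , c , d , length bs₄ ,
  cong (λ x → zeros a (true ∷ zeros b (true ∷ zeros c (true ∷ zeros d (true ∷ x))))) (no-marks bs₄ eq₄) ,
  trans (length-zeros a _) (trans (cong (λ x → a + suc x) (trans (length-zeros b _)
    (cong (λ x → b + suc x) (trans (length-zeros c _) (cong (λ x → c + suc x) (length-zeros d _))))))
    (arith a b c d (length bs₄)))
  where
  arith : ∀ a b c d e → a + suc (b + suc (c + suc (d + suc e))) ≡ 4 + (a + b + c + d + e)
  arith = solve-∀

-- Apart from the four marks there are 11 + 4 n bits, which gives both the residue 3 modulo 4 and
-- the lower bound 11; the leading `false` makes the first gap positive.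
window-path : ∀ bs n → count (false ∷ bs) ≡ 4 → length (false ∷ bs) ≡ 15 + n * 4 → Path opening (false ∷ bs)
window-path bs n four len with four-marks (false ∷ bs) four
... | suc a , b , c , d , e , refl , len′ = word-path (suc a) b c d e (s≤s z≤n)
        (trans (cong (_% 4) total) ([m+kn]%n≡m%n 11 n 4)) (subst (11 ≤_) (sym total) (m≤m+n 11 (n * 4)))
  where
  total : suc a + b + c + d + e ≡ 11 + n * 4
  total = +-cancelˡ-≡ 4 _ _ (trans (sym len′) len)

-- Windows of a cyclic word

nth : List Bool → ℕ → Bool
nth [] i = false
nth (b ∷ bs) zero = b
nth (b ∷ bs) (suc i) = nth bs i

segment : (ℕ → Bool) → ℕ → ℕ → List Bool
segment f i zero = []
segment f i (suc n) = f i ∷ segment f (suc i) n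

length-segment : ∀ f i n → length (segment f i n) ≡ n
length-segment f i zero = refl
length-segment f i (suc n) = cong suc (length-segment f (suc i) n)

segment-+ : ∀ f i m n → segment f i (m + n) ≡ segment f i m ++ segment f (i + m) n
segment-+ f i zero n = cong (λ j → segment f j n) (sym (+-identityʳ i))
segment-+ f i (suc m) n = cong (f i ∷_) (trans (segment-+ f (suc i) m n)
  (cong (λ j → segment f (suc i) m ++ segment f j n) (sym (+-suc i m))))

segment-nth : ∀ f bs i → (∀ j → j < length bs → f (i + j) ≡ nth bs j) → segment f i (length bs) ≡ bs
segment-nth f [] i h = refl
segment-nth f (b ∷ bs) i h = cong₂ _∷_ (trans (cong f (sym (+-identityʳ i))) (h 0 z<s))
  (segment-nth f bs (suc i) λ j j< → trans (cong f (sym (+-suc i j))) (h (suc j) (s<s j<)))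

module Cyclic (f : ℕ → Bool) (n : ℕ) (periodic : ∀ i → f (i + suc n) ≡ f i) where

  N : ℕ
  N = suc n

  cnt : ℕ → ℕ → ℕ
  cnt i n = count (segment f i n)

  cnt-+ : ∀ i m n → cnt i (m + n) ≡ cnt i m + cnt (i + m) n
  cnt-+ i m n = trans (cong count (segment-+ f i m n)) (count-++ (segment f i m) _)

  cnt-1 : ∀ i → cnt i 1 ≡ ⌊ f i ⌋
  cnt-1 i with f i
  ... | true = refl
  ... | false = refl

  cnt-slide : ∀ i n → ⌊ f i ⌋ + cnt (suc i) n ≡ cnt i n + ⌊ f (i + n) ⌋
  cnt-slide i n = begin
    ⌊ f i ⌋ + cnt (suc i) n ≡⟨ cong₂ _+_ (sym (cnt-1 i)) (cong (λ j → cnt j n) (+-comm 1 i)) ⟩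
    cnt i 1 + cnt (i + 1) n ≡⟨ sym (cnt-+ i 1 n) ⟩
    cnt i (1 + n)           ≡⟨ cong (cnt i) (+-comm 1 n) ⟩
    cnt i (n + 1)           ≡⟨ cnt-+ i n 1 ⟩
    cnt i n + cnt (i + n) 1 ≡⟨ cong (cnt i n +_) (cnt-1 (i + n)) ⟩
    cnt i n + ⌊ f (i + n) ⌋ ∎
    where open ≡-Reasoning

  cnt-period : ∀ i → cnt i N ≡ cnt 0 N
  cnt-period zero = refl
  cnt-period (suc i) = trans (+-cancelˡ-≡ ⌊ f i ⌋ _ _ (trans (cnt-slide i N)
    (trans (+-comm (cnt i N) _) (cong (λ b → ⌊ b ⌋ + cnt i N) (periodic i))))) (cnt-period i)

  cnt-periods : ∀ q i → cnt i (q * N) ≡ q * cnt 0 N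
  cnt-periods zero i = refl
  cnt-periods (suc q) i = trans (cnt-+ i N (q * N)) (cong₂ _+_ (cnt-period i) (cnt-periods q (i + N)))

  module _ (w : ℕ) where

    blocks-≥ : ∀ {c} q i → (∀ j → j < q → c ≤ cnt (i + j * w) w) → q * c ≤ cnt i (q * w)
    blocks-≥ zero i h = z≤n
    blocks-≥ {c} (suc q) i h = subst (suc q * c ≤_) (sym (cnt-+ i w (q * w)))
      (+-mono-≤ (subst (λ j → c ≤ cnt j w) (+-identityʳ i) (h 0 z<s))
        (blocks-≥ q (i + w) λ j j<q → subst (λ k → c ≤ cnt k w) (sym (+-assoc i w (j * w))) (h (suc j) (s<s j<q))))

    blocks-≤ : ∀ {c} q i → (∀ j → j < q → cnt (i + j * w) w ≤ c) → cnt i (q * w) ≤ q * c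
    blocks-≤ zero i h = z≤n
    blocks-≤ {c} (suc q) i h = subst (_≤ suc q * c) (sym (cnt-+ i w (q * w)))
      (+-mono-≤ (subst (λ j → cnt j w ≤ c) (+-identityʳ i) (h 0 z<s))
        (blocks-≤ q (i + w) λ j j<q → subst (λ k → cnt k w ≤ c) (sym (+-assoc i w (j * w))) (h (suc j) (s<s j<q))))

    -- N windows laid end to end wind around the cycle w times. This fixes the average over windows,
    -- from which a sparse or a dense one is obtained.
    total : ∀ i → cnt i (N * w) ≡ w * cnt 0 N
    total i = trans (cong (cnt i) (*-comm N w)) (cnt-periods w i)

    sparse : ∀ {c} i → w * cnt 0 N < N * suc c → ∃[ j ] cnt (i + j * w) w ≤ c
    sparse {c} i lt with anyUpTo? (λ j → cnt (i + j * w) w ≤? c) N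
    ... | yes (j , _ , p) = j , p
    ... | no ∄ = ⊥-elim (<⇒≱ lt (subst (N * suc c ≤_) (total i)
      (blocks-≥ N i λ j j<N → ≰⇒> (λ p → ∄ (j , j<N , p)))))

    dense : ∀ {c} i → N * c < w * cnt 0 N → ∃[ j ] c < cnt (i + j * w) w
    dense {c} i lt with anyUpTo? (λ j → suc c ≤? cnt (i + j * w) w) N
    ... | yes (j , _ , p) = j , p
    ... | no ∄ = ⊥-elim (<⇒≱ lt (subst (_≤ N * c) (total i)
      (blocks-≤ N i λ j j<N → ≮⇒≥ (λ p → ∄ (j , j<N , p)))))

    crossing : ∀ {c} t i → cnt i w ≤ c → c < cnt (i + t) w → ∃[ j ] cnt j w ≤ c × c < cnt (suc j) w
    crossing zero i lo hi = ⊥-elim (<⇒≱ hi (subst (λ j → cnt j w ≤ _) (sym (+-identityʳ i)) lo))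
    crossing {c} (suc t) i lo hi with cnt (suc i) w ≤? c
    ... | yes lo′ = crossing t (suc i) lo′ (subst (λ j → c < cnt j w) (+-suc i t) hi)
    ... | no ≰c = i , lo , ≰⇒> ≰c

    -- Sliding a window by one position raises its count only by dropping an unmarked bit and
    -- gaining a marked one, and then by exactly one.
    crossing-bits : ∀ {c} j → cnt j w ≤ c → c < cnt (suc j) w → f j ≡ false × cnt j w ≡ c × f (j + w) ≡ true
    crossing-bits {c} j lo hi = bits (f j) (f (j + w)) (cnt-slide j w)
      where
      bits : ∀ a b → ⌊ a ⌋ + cnt (suc j) w ≡ cnt j w + ⌊ b ⌋ → a ≡ false × cnt j w ≡ c × b ≡ true
      bits false true eq = refl , ≤-antisym lo (s≤s⁻¹ (subst (suc c ≤_) (trans eq (+-comm _ 1)) hi)) , refl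
      bits false false eq = ⊥-elim (<⇒≱ hi (subst (_≤ c) (sym (trans eq (+-identityʳ _))) lo))
      bits true true eq = ⊥-elim (<⇒≱ hi (subst (_≤ c) (sym (suc-injective (trans eq (+-comm _ 1)))) lo))
      bits true false eq = ⊥-elim (<⇒≱ hi (≤-trans (n≤1+n _) (subst (_≤ c) (sym (trans eq (+-identityʳ _))) lo)))

    -- A discrete intermediate value argument along the windows of length w.
    transition : ∀ {c} i → cnt i w ≤ c → N * c < w * cnt 0 N →
      ∃[ j ] f j ≡ false × cnt j w ≡ c × f (j + w) ≡ true
    transition i lo lt with dense i lt
    ... | t , hi with crossing (t * w) i lo hi
    ... | j , lo′ , hi′ = j , crossing-bits j lo′ hi′

    -- The n windows that follow already account for n c of the total, which leaves at most c for
    -- the window at i.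
    even : ∀ {c} → (∀ i → c ≤ cnt i w) → N * c ≡ w * cnt 0 N → ∀ i → cnt i w ≡ c
    even {c} h average i = ≤-antisym (+-cancelʳ-≤ (n * c) _ _ (≤-trans
      (+-monoʳ-≤ (cnt i w) (blocks-≥ n (i + w) λ j _ → h (i + w + j * w)))
      (≤-reflexive (trans (sym (cnt-+ i w (n * w))) (trans (total i) (sym average)))))) (h i)

    even-shift : ∀ {c} → (∀ i → cnt i w ≡ c) → ∀ i → f i ≡ f (i + w)
    even-shift {c} h i = equal-bits (f i) (f (i + w))
      (trans (cong (⌊ f i ⌋ +_) (sym (h (suc i)))) (trans (cnt-slide i w) (cong (_+ ⌊ f (i + w) ⌋) (h i))))
      where
      equal-bits : ∀ a b → ⌊ a ⌋ + c ≡ c + ⌊ b ⌋ → a ≡ b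
      equal-bits true true eq = refl
      equal-bits false false eq = refl
      equal-bits true false eq = ⊥-elim (1+n≢n (trans eq (+-identityʳ c)))
      equal-bits false true eq = ⊥-elim (1+n≢n (sym (trans eq (+-comm c 1))))

    -- Reduces the search for a sparse window to N starting positions, which makes it decidable.
    cnt-mod : ∀ i → cnt (i % N) w ≡ cnt i w
    cnt-mod i = trans (sym (cnt-+N (i / N) (i % N))) (cong (λ j → cnt j w) (sym (m≡m%n+[m/n]*n i N)))
      where
      segment-+N : ∀ i m → segment f (i + N) m ≡ segment f i m
      segment-+N i zero = refl
      segment-+N i (suc m) = cong₂ _∷_ (periodic i) (segment-+N (suc i) m)
      cnt-+N : ∀ q i → cnt (i + q * N) w ≡ cnt i w
      cnt-+N zero i = cong (λ j → cnt j w) (+-identityʳ i)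
      cnt-+N (suc q) i = trans (cong (λ j → cnt j w) (sym (+-assoc i N (q * N))))
        (trans (cnt-+N q (i + N)) (cong count (segment-+N i w)))

    sparse⊎even : ∀ {c} → N * suc c ≡ w * cnt 0 N → (∃[ i ] cnt i w ≤ c) ⊎ (∀ i → f i ≡ f (i + w))
    sparse⊎even {c} average with anyUpTo? (λ j → cnt j w ≤? c) N
    ... | yes (i , _ , lo) = inj₁ (i , lo)
    ... | no ∄ = inj₂ (even-shift (even (λ i → subst (suc c ≤_) (cnt-mod i)
                      (≰⇒> λ lo → ∄ (i % N , m%n<n i N , lo))) average))

  unrotate : ∀ {k} i → Tour k (segment f i N) → Tour k (segment f 0 N)
  unrotate zero t = t
  unrotate {k} (suc i) t = unrotate i (rotate [ f i ] (segment f (suc i) n) (subst (Tour k) eq t))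
    where
    eq : segment f (suc i) (suc n) ≡ segment f (suc i) n ++ [ f i ]
    eq = trans (cong (segment f (suc i)) (+-comm 1 n)) (trans (segment-+ f (suc i) n 1)
      (cong (λ b → segment f (suc i) n ++ [ b ]) (trans (cong f (sym (+-suc i n))) (periodic i))))

  -- Turns the word so that it starts with the window found. The first bit of the window and the
  -- first bit behind it are known, so `v` and `r` are one less than the lengths of the two parts.
  window-tour : ∀ {k c} v r → N ≡ suc v + suc r → (∃[ j ] f j ≡ false × cnt j (suc v) ≡ c × f (j + suc v) ≡ true) →
    (∀ us vs → length us ≡ v → count us ≡ c → length vs ≡ r → c + suc (count vs) ≡ cnt 0 N →
      Tour k (false ∷ us ++ true ∷ vs)) → Tour k (segment f 0 N)
  window-tour {k} {c} v r N≡ (j , fj , marked , fjw) window = unrotate j (subst (Tour k) (sym shape)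
    (window us vs (length-segment f (suc j) v) us-marks (length-segment f (suc (j + suc v)) r) total-marks))
    where
    us vs : List Bool
    us = segment f (suc j) v
    vs = segment f (suc (j + suc v)) r
    shape : segment f j N ≡ false ∷ us ++ true ∷ vs
    shape = trans (cong (segment f j) N≡) (trans (segment-+ f j (suc v) (suc r))
      (cong₂ (λ a b → a ∷ us ++ b ∷ vs) fj fjw))
    us-marks : count us ≡ c
    us-marks = trans (cong (λ b → count (b ∷ us)) (sym fj)) marked
    total-marks : c + suc (count vs) ≡ cnt 0 N
    total-marks = trans (cong (_+ suc (count vs)) (sym us-marks)) (trans (sym (count-++ us (true ∷ vs)))
      (trans (cong count (sym shape)) (cnt-period j)))

module Periodise (bs : List Bool) (n : ℕ) (len : length bs ≡ suc n) where

  f : ℕ → Bool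
  f i = nth bs (i % suc n)

  periodic : ∀ i → f (i + suc n) ≡ f i
  periodic i = cong (nth bs) ([m+n]%n≡m%n i (suc n))

  segment≡ : segment f 0 (suc n) ≡ bs
  segment≡ = trans (cong (segment f 0) (sym len))
    (segment-nth f bs 0 λ j j< → cong (nth bs) (m<n⇒m%n≡m (subst (j <_) len j<)))

-- Euler tours of K_5

everyList : ℕ → ℕ → (List Bool → Bool) → Bool
everyList zero zero P = P []
everyList zero (suc c) P = true
everyList (suc n) zero P = everyList n zero (P ∘ (false ∷_))
everyList (suc n) (suc c) P = everyList n (suc c) (P ∘ (false ∷_)) ∧ everyList n c (P ∘ (true ∷_))

everyList-sound : ∀ n c P → T (everyList n c P) → ∀ bs → length bs ≡ n → count bs ≡ c → T (P bs)
everyList-sound zero zero P t [] refl refl = t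
everyList-sound (suc n) zero P t (false ∷ bs) refl eq = everyList-sound n zero (P ∘ (false ∷_)) t bs refl eq
everyList-sound (suc n) (suc c) P t (false ∷ bs) refl eq =
  everyList-sound n (suc c) (P ∘ (false ∷_)) (proj₁ (Equivalence.to T-∧ t)) bs refl eq
everyList-sound (suc n) (suc c) P t (true ∷ bs) refl eq =
  everyList-sound n c (P ∘ (true ∷_)) (proj₂ (Equivalence.to (T-∧ {everyList n (suc c) (P ∘ (false ∷_))}) t)) bs refl (suc-injective eq)

everyPair : ∀ {M : List Bool → Set} → ℕ → ℕ → ℕ → ℕ → (∀ us → M us) → (∀ us → M us → List Bool → Bool) → Bool
everyPair m b n c F P = everyList m b λ us → everyList n c (P us (F us))

everyPair-sound : ∀ {M : List Bool → Set} m b n c (F : ∀ us → M us) (P : ∀ us → M us → List Bool → Bool) →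
  everyPair m b n c F P ≡ true → ∀ us vs → length us ≡ m → count us ≡ b → length vs ≡ n → count vs ≡ c → T (P us (F us) vs)
everyPair-sound m b n c F P eq us vs len marked = everyList-sound n c (P us (F us))
  (everyList-sound m b (λ us → everyList n c (P us (F us))) (subst T (sym eq) tt) us len marked) vs

everySolution : ∀ n c {P : List Bool → Set} (f : ∀ bs → Maybe (P bs)) →
  T (everyList n c λ bs → is-just (f bs)) → ∀ bs → length bs ≡ n → count bs ≡ c → P bs
everySolution n c f t bs len marked = from-just (f bs) (everyList-sound n c (λ bs → is-just (f bs)) t bs len marked)

unique? : (xs : List ℕ) → Dec (Unique xs)
unique? = allPairs? λ x y → ¬? (x ≟ y)

uniqueEdges? : (es : List Edge) → Dec (Unique es)
uniqueEdges? = allPairs? λ e e′ → ¬? (≡-dec _≟_ _≟_ e e′)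

proper? : (es : List Edge) → Dec (All Proper es)
proper? = all? λ e → ¬? (proj₁ e ≟ proj₂ e)

record Circuit (k : ℕ) : Set where
  constructor mkCircuit
  field
    vertices : List ℕ
    bounded  : All (_< k) vertices
    unique   : Unique (closed vertices)
    proper   : All Proper (closed vertices)

circuit : ∀ k vs {_ : True (all? (_<? k) vs ×-dec uniqueEdges? (closed vs) ×-dec proper? (closed vs))} → Circuit k
circuit k vs {t} = let bd , un , pr = toWitness t in mkCircuit vs bd un pr

-- Three Euler tours and their rotations suffice for every pattern that is not exceptional, as
-- `ordinary-table` verifies.
circuits : List (Circuit 5)
circuits = circuit 5 (0 ∷ 1 ∷ 2 ∷ 0 ∷ 3 ∷ 1 ∷ 4 ∷ 2 ∷ 3 ∷ 4 ∷ [])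
         ∷ circuit 5 (0 ∷ 1 ∷ 2 ∷ 0 ∷ 3 ∷ 1 ∷ 4 ∷ 3 ∷ 2 ∷ 4 ∷ [])
         ∷ circuit 5 (0 ∷ 1 ∷ 2 ∷ 0 ∷ 3 ∷ 2 ∷ 4 ∷ 3 ∷ 1 ∷ 4 ∷ [])
         ∷ []

-- bs starts, after a rotation by xs, at the first vertex of the circuit.
data Placed (bs : List Bool) : Set where
  placed : ∀ xs ys (Γ : Circuit 5) → bs ≡ xs ++ ys → length (ys ++ xs) ≡ length (Circuit.vertices Γ) →
    Unique (select (ys ++ xs) (Circuit.vertices Γ)) → Placed bs

module _ (bs : List Bool) where

  onCircuits : ℕ → List (Circuit 5) → Maybe (Placed bs)
  onCircuits j [] = nothing
  onCircuits j (Γ ∷ Γs)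
    with length (drop j bs ++ take j bs) ≟ length (Circuit.vertices Γ)
       | unique? (select (drop j bs ++ take j bs) (Circuit.vertices Γ))
  ... | yes len | yes un = just (placed (take j bs) (drop j bs) Γ (sym (take++drop≡id j bs)) len un)
  ... | yes len | no _ = onCircuits j Γs
  ... | no _ | _ = nothing

  place : ℕ → Maybe (Placed bs)
  place zero = nothing
  place (suc j) = onCircuits j circuits orElse place j

placed-tour : ∀ {bs} → Placed bs → Tour 5 bs
placed-tour (placed xs ys (mkCircuit vs bd un pr) refl len tr) = rotate xs ys (mkTour vs len bd un pr tr)

-- Up to rotation, these are the only two positions of five marks that no
-- Euler tour of K_5 meets in five distinct vertices.
forbidden : List Bool → Bool
forbidden (true ∷ true ∷ true ∷ false ∷ true ∷ false ∷ false ∷ false ∷ true ∷ false ∷ []) = true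
forbidden (true ∷ true ∷ false ∷ true ∷ true ∷ false ∷ false ∷ true ∷ false ∷ false ∷ []) = true
forbidden _ = false

exceptional : List Bool → Bool
exceptional = rotations 10
  where
  rotations : ℕ → List Bool → Bool
  rotations (suc j) bs@(c ∷ cs) = forbidden bs ∨ rotations j (cs ∷ʳ c)
  rotations _ _ = false

ordinary : List Bool → Bool
ordinary bs = exceptional bs ∨ is-just (place bs 10)

abstract
  ordinary-table : T (everyList 10 5 ordinary)
  ordinary-table = tt

tour-5 : ∀ bs → length bs ≡ 10 → count bs ≡ 5 → T (not (exceptional bs)) → Tour 5 bs
tour-5 bs len five ok = found (exceptional bs) (everyList-sound 10 5 ordinary ordinary-table bs len five) ok
  where
  found : ∀ b → T (b ∨ is-just (place bs 10)) → T (not b) → Tour 5 bs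
  found false t _ = placed-tour (from-just _ t)

-- Euler tours of K_7

Reducible : List Bool → List Bool → Set
Reducible ws rest = Σ (Path opening ws) λ p → T (not (exceptional (shadowOf p rest)))

guard : ∀ b → Maybe (T b)
guard true = just tt
guard false = nothing

-- A path that leaves an exceptional pattern on K_5 is rejected inside the search, which then goes
-- on to other insertions.
reduce : ∀ ws rest → Maybe (Reducible ws rest)
reduce ws rest = search 2 true ws λ p → attach p (guard _)
  where
  attach : ∀ p → Maybe (T (not (exceptional (shadowOf p rest)))) → Maybe (Reducible ws rest)
  attach p (just t) = just (p , t)
  attach p nothing = nothing

data Cut (bs : List Bool) : Set where
  cut : ∀ xs ys ws rest → bs ≡ xs ++ ys → ys ++ xs ≡ ws ++ rest → length ws ≡ 15 → Reducible ws rest → Cut bs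

module _ (bs : List Bool) where

  cutAt : ℕ → Maybe (Cut bs)
  cutAt j = try (take 15 turned) (drop 15 turned) (sym (take++drop≡id 15 turned))
    where
    turned : List Bool
    turned = drop j bs ++ take j bs
    try : ∀ ws rest → turned ≡ ws ++ rest → Maybe (Cut bs)
    try ws rest eq with length ws ≟ 15
    ... | no _ = nothing
    ... | yes len with reduce ws rest
    ...   | nothing = nothing
    ...   | just red = just (cut (take j bs) (drop j bs) ws rest (sym (take++drop≡id j bs)) eq len red)

  cuts : ℕ → ℕ → Maybe (Cut bs)
  cuts zero j = nothing
  cuts (suc m) j = cutAt j orElse cuts m (suc j)

cut-tour : ∀ {bs} → length bs ≡ 21 → count bs ≡ 7 → Cut bs → Tour 7 bs
cut-tour len seven (cut xs ys ws rest refl eq len-ws (p , ok)) =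
  rotate xs ys (subst (Tour 7) (sym eq) (shadow-tour p rest len-ws
    (tour-5 _ (trans (shadow-length p rest) (cong (4 +_) rest-length))
      (suc-injective (suc-injective (trans (sym (shadow-count p rest)) seven′))) ok)))
  where
  total : length (ws ++ rest) ≡ 21
  total = trans (cong length (sym eq)) (trans (length-++ ys) (trans (+-comm (length ys) _) (trans (sym (length-++ xs)) len)))
  rest-length : length rest ≡ 6
  rest-length = +-cancelˡ-≡ 15 _ _ (trans (cong (_+ length rest) (sym len-ws)) (trans (sym (length-++ ws)) total))
  seven′ : count (ws ++ rest) ≡ 7
  seven′ = trans (cong count (sym eq)) (trans (count-++ ys xs) (trans (+-comm (count ys) _) (trans (sym (count-++ xs ys)) seven)))

quick : ∀ ws rest → Maybe (Path opening (false ∷ ws)) → Bool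
quick ws rest (just p) = not (exceptional (shadowOf p (true ∷ rest)))
quick ws rest nothing = false

whole : ∀ {ws rest} → length ws ≡ 15 → Reducible ws rest → Cut (ws ++ rest)
whole {ws} {rest} len = cut [] (ws ++ rest) ws rest refl (++-identityʳ (ws ++ rest)) len

-- Two fallbacks: another insertion into the same window, and then windows starting at one of the
-- other twenty positions of the cycle of length 21.
thorough : List Bool → List Bool → Bool
thorough ws rest = is-just (reduce (false ∷ ws) (true ∷ rest)) ∨ is-just (cuts ((false ∷ ws) ++ true ∷ rest) 20 1)

-- The path m is computed only once for all choices of the last bits.
generic : ∀ ws → Maybe (Path opening (false ∷ ws)) → List Bool → Bool
generic ws m rest = quick ws rest m ∨ thorough ws rest

generic-tour : ∀ ws rest m → length ws ≡ 14 → count ws ≡ 4 → length rest ≡ 5 → count rest ≡ 2 →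
  T (generic ws m rest) → Tour 7 ((false ∷ ws) ++ true ∷ rest)
generic-tour ws rest m len four len′ double t = cut-tour
  (trans (length-++ (false ∷ ws)) (cong₂ (λ a b → suc a + suc b) len len′))
  (trans (count-++ (false ∷ ws) (true ∷ rest)) (cong₂ (λ a b → a + suc b) four double))
  (by m t)
  where
  by : ∀ m → T (generic ws m rest) → Cut ((false ∷ ws) ++ true ∷ rest)
  by m t with Equivalence.to (T-∨ {quick ws rest m}) t
  by (just p) t | inj₁ ok = whole (cong suc len) (p , ok)
  by nothing t | inj₁ ()
  by m t | inj₂ t′ with Equivalence.to (T-∨ {is-just (reduce (false ∷ ws) (true ∷ rest))}) t′
  ... | inj₁ r = whole (cong suc len) (from-just (reduce (false ∷ ws) (true ∷ rest)) r)
  ... | inj₂ c = from-just (cuts ((false ∷ ws) ++ true ∷ rest) 20 1) c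

abstract
  generic-table : everyPair 14 4 5 2 (λ ws → search 2 true (false ∷ ws) just) generic ≡ true
  generic-table = refl

window-tour-7 : ∀ ws rest → length ws ≡ 14 → count ws ≡ 4 → length rest ≡ 5 → count rest ≡ 2 →
  Tour 7 ((false ∷ ws) ++ true ∷ rest)
window-tour-7 ws rest len four len′ double = generic-tour ws rest (search 2 true (false ∷ ws) just) len four len′ double
  (everyPair-sound 14 4 5 2 (λ ws → search 2 true (false ∷ ws) just) generic generic-table ws rest len four len′ double)

-- Euler tours of larger complete graphs

Tours : ℕ → ℕ → Set
Tours k n = ∀ bs → length bs ≡ n → count bs ≡ k → Tour k bs

-- The number of bits behind a window and the marked bit after it, so that for k = `order q` the
-- length `size q` is k (k - 1) / 2.
remainder : ℕ → ℕ
remainder q = 5 + 9 * q + 2 * (q * q)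

order size : ℕ → ℕ
order q = 7 + q * 2
size q = 15 + q * 4 + suc (remainder q)

size≡ : ∀ q → size q ≡ order q * (3 + q)
size≡ q = arith q
  where
  arith : ∀ q → 15 + q * 4 + suc (5 + 9 * q + 2 * (q * q)) ≡ (7 + q * 2) * (3 + q)
  arith = solve-∀

size* : ∀ q c → size q * c ≡ order q * ((3 + q) * c)
size* q c = trans (cong (_* c) (size≡ q)) (*-assoc (order q) (3 + q) c)

module _ (q : ℕ) (bs : List Bool) (len : length bs ≡ size q) (marked : count bs ≡ order q) where

  open Periodise bs (14 + q * 4 + suc (remainder q)) len
  open Cyclic f (14 + q * 4 + suc (remainder q)) periodic

  w : ℕ
  w = 15 + q * 4

  total-marks : cnt 0 N ≡ order q
  total-marks = trans (cong count segment≡) marked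

  -- The average count of a window is (15 + 4 q) / (3 + q), and 4 (3 + q) = 12 + 4 q.
  crowded : N * 4 < w * cnt 0 N
  crowded = subst₂ _<_ (sym (size* q 4)) (trans (*-comm (order q) w) (cong (w *_) (sym total-marks)))
    (*-monoʳ-< (order q) (+-monoˡ-< (q * 4) {12} {15} (m≤m+n 13 2)))

  Windowed : Set
  Windowed = ∀ us vs → length us ≡ 14 + q * 4 → count us ≡ 4 →
    length vs ≡ remainder q → count vs ≡ 2 + q * 2 → Tour (order q) (false ∷ us ++ true ∷ vs)

  from-window : Windowed → ∀ i → cnt i w ≤ 4 → Tour (order q) bs
  from-window window i lo = subst (Tour (order q)) segment≡
    (window-tour (14 + q * 4) (remainder q) refl (transition w i lo crowded)
      λ us vs len-us four len-vs others → window us vs len-us four len-vs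
        (+-cancelˡ-≡ 5 _ _ (trans (sym (+-suc 4 (count vs))) (trans others total-marks))))

step : ∀ q → Tours (5 + q * 2) (10 + 9 * q + 2 * (q * q)) → 1 ≤ q → Tours (order q) (size q)
step q smaller 1≤q bs len marked = from-window q bs len marked window (proj₁ thin * w′) (proj₂ thin)
  where
  open Periodise bs (14 + q * 4 + suc (remainder q)) len
  open Cyclic f (14 + q * 4 + suc (remainder q)) periodic
  w′ = 15 + q * 4
  -- Here (15 + 4 q) / (3 + q) is compared with 5 (3 + q) = 15 + 5 q; the inequality is strict
  -- because q is positive.
  below-five : w′ * cnt 0 N < N * 5
  below-five = subst₂ _<_ (trans (*-comm (order q) w′) (cong (w′ *_) (sym (total-marks q bs len marked)))) (sym (size* q 5))
    (*-monoʳ-< (order q) (+-monoʳ-< 15 (*-monoʳ-< q ⦃ >-nonZero 1≤q ⦄ (n<1+n 4))))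
  thin = sparse w′ {4} 0 below-five
  window : Windowed q bs len marked
  window us vs len-us four len-vs others = shadow-tour p (true ∷ vs) len-ws
    (smaller _ (trans (shadow-length p (true ∷ vs)) (cong (5 +_) len-vs))
      (suc-injective (suc-injective (trans (sym (shadow-count p (true ∷ vs)))
        (trans (count-++ (false ∷ us) (true ∷ vs)) (cong₂ (λ a b → a + suc b) four others))))))
    where
    p = window-path us q four (cong suc len-us)
    len-ws : suc (length us) ≡ 2 * (5 + q * 2) + 5
    len-ws = trans (cong suc len-us) (arith q)
      where
      arith : ∀ q → 15 + q * 4 ≡ 2 * (5 + q * 2) + 5
      arith = solve-∀

repeat : ℕ → Bool → Bool → Bool → List Bool
repeat zero x y z = []
repeat (suc m) x y z = x ∷ y ∷ z ∷ repeat m x y z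

segment-repeat : ∀ f m i → (∀ j → f (3 + j) ≡ f j) →
  segment f i (m * 3) ≡ repeat m (f i) (f (1 + i)) (f (2 + i))
segment-repeat f zero i h = refl
segment-repeat f (suc m) i h = cong (λ bs → f i ∷ f (1 + i) ∷ f (2 + i) ∷ bs)
  (trans (segment-repeat f m (3 + i) h) (cong₃ (repeat m) (h i) (h (1 + i)) (h (2 + i))))
  where
  cong₃ : ∀ {A B : Set} (g : A → A → A → B) {a a′ b b′ c c′} → a ≡ a′ → b ≡ b′ → c ≡ c′ → g a b c ≡ g a′ b′ c′
  cong₃ g refl refl refl = refl

-- Seven marks in seven periods leave one mark per period, and one of the first two rotations is
-- reducible.
repeat-tour : ∀ x y z → count (repeat 7 x y z) ≡ 7 → Tour 7 (repeat 7 x y z)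
repeat-tour true false false eq = cut-tour refl refl (from-just (cuts (repeat 7 true false false) 2 0) tt)
repeat-tour false true false eq = cut-tour refl refl (from-just (cuts (repeat 7 false true false) 2 0) tt)
repeat-tour false false true eq = cut-tour refl refl (from-just (cuts (repeat 7 false false true) 2 0) tt)
repeat-tour true true true ()
repeat-tour true true false ()
repeat-tour true false true ()
repeat-tour false true true ()
repeat-tour false false false ()

window-7 : ∀ bs len marked → Windowed 0 bs len marked
window-7 bs len marked = window-tour-7

-- The periods 15 and 21 combine as 3 = 3 · 15 - 2 · 21.
shift-3 : ∀ (f : ℕ → Bool) → (∀ i → f (i + 21) ≡ f i) → (∀ i → f i ≡ f (i + 15)) → ∀ i → f (3 + i) ≡ f i
shift-3 f periodic shift i = trans (sym (periodic (3 + i))) (trans (sym (periodic (3 + i + 21)))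
  (trans (cong f (arith i)) (sym (trans (shift i) (trans (shift (i + 15)) (shift (i + 15 + 15)))))))
  where
  arith : ∀ i → 3 + i + 21 + 21 ≡ i + 15 + 15 + 15
  arith = solve-∀

tours-7 : Tours (order 0) (size 0)
tours-7 bs len marked = by (sparse⊎even (w 0 bs len marked) (cong (15 *_) (sym (total-marks 0 bs len marked))))
  where
  open Periodise bs (14 + 0 * 4 + suc (remainder 0)) len
  open Cyclic f (14 + 0 * 4 + suc (remainder 0)) periodic
  by : (∃[ i ] cnt i (w 0 bs len marked) ≤ 4) ⊎ (∀ i → f i ≡ f (i + w 0 bs len marked)) → Tour (order 0) bs
  by (inj₁ (i , lo)) = from-window 0 bs len marked (window-7 bs len marked) i lo
  by (inj₂ shift) = subst (Tour 7) (trans (sym shape) segment≡)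
      (repeat-tour _ _ _ (trans (cong count (sym shape)) (trans (cong count segment≡) marked)))
    where
    shape : segment f 0 21 ≡ repeat 7 (f 0) (f 1) (f 2)
    shape = segment-repeat f 7 0 (shift-3 f periodic shift)

tours : ∀ q → Tours (order q) (size q)
tours zero = tours-7
tours (suc q) = step (suc q) (λ bs len → tours q bs (trans len (arith q))) (s≤s z≤n)
  where
  arith : ∀ q → 10 + 9 * suc q + 2 * (suc q * suc q) ≡ 15 + q * 4 + suc (5 + 9 * q + 2 * (q * q))
  arith = solve-∀

-- From tours to drawings

trail : List ℕ → List Edge
trail [] = []
trail (v ∷ vs) = walk v vs

hairs : List Bool → List ℕ → List ℕ → List Edge
hairs (true ∷ μ) (v ∷ vs) (x ∷ xs) = edge x v ∷ hairs μ vs xs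
hairs (false ∷ μ) (v ∷ vs) (x ∷ xs) = hairs μ vs xs
hairs _ _ _ = []

-- Images of the spine y_0, ..., y_ℓ and, at each marked position, of the leaf
-- attached there; the entries of tips at unmarked positions are irrelevant.
record Drawing (k : ℕ) (μ : List Bool) : Set where
  constructor mkDrawing
  field
    spine tips   : List ℕ
    spine-length : length spine ≡ suc (length μ)
    tips-length  : length tips ≡ length μ
    spine<k      : All (_< k) spine
    tips<k       : All (_< k) tips
    unique       : Unique (trail spine ++ hairs μ spine tips)

-- A contraction of the spine to a closed trail without loops: two consecutive
-- unmarked vertices joined by a loop become one marked vertex.
data Contract : List Bool → List Bool → Set where
  []    : Contract [] []
  bare : ∀ {μ bs} → Contract μ bs → Contract (false ∷ μ) (false ∷ bs)
  leaf  : ∀ {μ bs} → Contract μ bs → Contract (true ∷ μ) (true ∷ bs)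
  loop  : ∀ {μ bs} → Contract μ bs → Contract (false ∷ false ∷ μ) (true ∷ bs)

expand : ∀ {μ bs} → Contract μ bs → List ℕ → List ℕ
expand (bare c) (v ∷ vs) = v ∷ expand c vs
expand (leaf c) (v ∷ vs) = v ∷ expand c vs
expand (loop c) (v ∷ vs) = v ∷ v ∷ expand c vs
expand _ _ = []

looped leaved : ∀ {μ bs} → Contract μ bs → List ℕ → List ℕ
looped (bare c) (v ∷ vs) = looped c vs
looped (leaf c) (v ∷ vs) = looped c vs
looped (loop c) (v ∷ vs) = v ∷ looped c vs
looped _ _ = []
leaved (bare c) (v ∷ vs) = leaved c vs
leaved (leaf c) (v ∷ vs) = v ∷ leaved c vs
leaved (loop c) (v ∷ vs) = leaved c vs
leaved _ _ = []

expand-length : ∀ {μ bs} (c : Contract μ bs) vs → length bs ≡ length vs → length (expand c vs) ≡ length μ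
expand-length [] [] eq = refl
expand-length (bare c) (v ∷ vs) eq = cong suc (expand-length c vs (suc-injective eq))
expand-length (leaf c) (v ∷ vs) eq = cong suc (expand-length c vs (suc-injective eq))
expand-length (loop c) (v ∷ vs) eq = cong (2 +_) (expand-length c vs (suc-injective eq))

expand-All : ∀ {P : ℕ → Set} {μ bs} (c : Contract μ bs) {vs} → All P vs → All P (expand c vs)
expand-All [] ps = []
expand-All (bare c) [] = []
expand-All (leaf c) [] = []
expand-All (loop c) [] = []
expand-All (bare c) (p ∷ ps) = p ∷ expand-All c ps
expand-All (leaf c) (p ∷ ps) = p ∷ expand-All c ps
expand-All (loop c) (p ∷ ps) = p ∷ p ∷ expand-All c ps

selfLoop : ℕ → Edge
selfLoop v = edge v v

expand-walk : ∀ {μ bs} (c : Contract μ bs) vs u zs → length bs ≡ length vs →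
  walk u (expand c vs ++ zs) ↭ map selfLoop (looped c vs) ++ walk u (vs ++ zs)
expand-walk [] [] u zs eq = ↭-refl
expand-walk (bare c) (v ∷ vs) u zs eq = ↭-trans (prep _ (expand-walk c vs v zs (suc-injective eq)))
  (↭-sym (shift (edge u v) (map selfLoop (looped c vs)) _))
expand-walk (leaf c) (v ∷ vs) u zs eq = ↭-trans (prep _ (expand-walk c vs v zs (suc-injective eq)))
  (↭-sym (shift (edge u v) (map selfLoop (looped c vs)) _))
expand-walk (loop c) (v ∷ vs) u zs eq = ↭-trans (prep _ (prep _ (expand-walk c vs v zs (suc-injective eq))))
  (↭-trans (_↭_.swap _ _ ↭-refl) (prep _ (↭-sym (shift (edge u v) (map selfLoop (looped c vs)) _))))

expand-hairs : ∀ {μ bs} (c : Contract μ bs) vs zs → length bs ≡ length vs →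
  hairs μ (expand c vs ++ zs) (expand c vs) ≡ map selfLoop (leaved c vs)
expand-hairs [] [] zs eq = refl
expand-hairs (bare c) (v ∷ vs) zs eq = expand-hairs c vs zs (suc-injective eq)
expand-hairs (leaf c) (v ∷ vs) zs eq = cong (_ ∷_) (expand-hairs c vs zs (suc-injective eq))
expand-hairs (loop c) (v ∷ vs) zs eq = expand-hairs c vs zs (suc-injective eq)

expand-select : ∀ {μ bs} (c : Contract μ bs) vs → length bs ≡ length vs →
  looped c vs ++ leaved c vs ↭ select bs vs
expand-select [] [] eq = ↭-refl
expand-select (bare c) (v ∷ vs) eq = expand-select c vs (suc-injective eq)
expand-select (leaf c) (v ∷ vs) eq = ↭-trans (shift v (looped c vs) (leaved c vs)) (prep v (expand-select c vs (suc-injective eq)))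
expand-select (loop c) (v ∷ vs) eq = prep v (expand-select c vs (suc-injective eq))

selfLoop-injective : ∀ {u v} → selfLoop u ≡ selfLoop v → u ≡ v
selfLoop-injective {u} {v} eq = trans (sym (⊔-idem u)) (trans (cong proj₁ eq) (⊔-idem v))

-- Every leaf is placed on its spine vertex, so leaf edges are loops. Together with the loops on the
-- spine they sit at the marked vertices of the tour, which transversality makes distinct; the tour
-- itself has no loops.
contract-drawing : ∀ {k μ bs} → Contract μ bs → 1 ≤ length bs → Tour k bs → Drawing k μ
contract-drawing {bs = []} c () t
contract-drawing {k} {μ} {bs@(b ∷ _)} c _ (mkTour (v ∷ vs) len bd un pr tr) =
  mkDrawing (expand c (v ∷ vs) ++ [ v ]) (expand c (v ∷ vs))
    (trans (length-++ (expand c (v ∷ vs))) (trans (+-comm _ 1) (cong suc (expand-length c (v ∷ vs) len))))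
    (expand-length c (v ∷ vs) len)
    (Allₚ.++⁺ (expand-All c bd) (All.head bd ∷ []))
    (expand-All c bd)
    (Unique-resp-↭ (↭-sym edges) (Unique-++⁺ un (Unique-map⁺ selfLoop-injective tr)
      (All.map (λ p e∈ → case ∈-map⁻ selfLoop e∈ of λ { (x , _ , refl) → p (trans (⊔-idem x) (sym (⊓-idem x))) }) pr)))
  where
  headed : ∀ {μ bs} (c : Contract μ bs) v vs → 1 ≤ length bs → ∃[ ws ] expand c (v ∷ vs) ≡ v ∷ ws
  headed (bare c) v vs _ = _ , refl
  headed (leaf c) v vs _ = _ , refl
  headed (loop c) v vs _ = _ , refl
  trail-edges : trail (expand c (v ∷ vs) ++ [ v ]) ↭ map selfLoop (looped c (v ∷ vs)) ++ closed (v ∷ vs)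
  -- The walk is started at an auxiliary vertex 0, so that `expand-walk` applies to the whole list;
  -- the extra first edge is the same on both sides and is cancelled.
  trail-edges = cancel (headed c v vs (s≤s z≤n)) (expand-walk c (v ∷ vs) 0 [ v ] len)
    where
    cancel : ∀ {es} → ∃[ ws ] es ≡ v ∷ ws →
      walk 0 (es ++ [ v ]) ↭ map selfLoop (looped c (v ∷ vs)) ++ edge 0 v ∷ closed (v ∷ vs) →
      trail (es ++ [ v ]) ↭ map selfLoop (looped c (v ∷ vs)) ++ closed (v ∷ vs)
    cancel (ws , refl) p = drop-∷ (↭-trans p (shift (edge 0 v) (map selfLoop (looped c (v ∷ vs))) _))
  edges : trail (expand c (v ∷ vs) ++ [ v ]) ++ hairs μ (expand c (v ∷ vs) ++ [ v ]) (expand c (v ∷ vs)) ↭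
    closed (v ∷ vs) ++ map selfLoop (select bs (v ∷ vs))
  edges = ↭-trans (++⁺ (↭-trans trail-edges (++-comm (map selfLoop (looped c (v ∷ vs))) (closed (v ∷ vs))))
      (↭-reflexive (expand-hairs c (v ∷ vs) [ v ] len)))
    (↭-trans (↭-reflexive (++-assoc (closed (v ∷ vs)) _ _))
      (++⁺ˡ (closed (v ∷ vs)) (↭-trans (↭-reflexive (sym (map-++ selfLoop (looped c (v ∷ vs)) _)))
        (map⁺ selfLoop (expand-select c (v ∷ vs) len)))))

pairs : List Bool → ℕ
pairs [] = 0
pairs (true ∷ μ) = pairs μ
pairs (false ∷ []) = 0
pairs (false ∷ true ∷ μ) = pairs μ
pairs (false ∷ false ∷ μ) = suc (pairs μ)

-- Each maximal run of unmarked positions leaves at most one of them unpaired.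
length≤pairs : ∀ μ → length μ ≤ 2 * pairs μ + 2 * count μ + 1
length≤pairs [] = z≤n
length≤pairs (true ∷ μ) = ≤-trans (s≤s (length≤pairs μ)) (≤-trans (n≤1+n _) (≤-reflexive (arith (pairs μ) (count μ))))
  where
  arith : ∀ p c → 2 + (2 * p + 2 * c + 1) ≡ 2 * p + 2 * suc c + 1
  arith = solve-∀
length≤pairs (false ∷ []) = s≤s z≤n
length≤pairs (false ∷ true ∷ μ) = ≤-trans (s≤s (s≤s (length≤pairs μ))) (≤-reflexive (arith (pairs μ) (count μ)))
  where
  arith : ∀ p c → 2 + (2 * p + 2 * c + 1) ≡ 2 * p + 2 * suc c + 1
  arith = solve-∀
length≤pairs (false ∷ false ∷ μ) = ≤-trans (s≤s (s≤s (length≤pairs μ))) (≤-reflexive (arith (pairs μ) (count μ)))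
  where
  arith : ∀ p c → 2 + (2 * p + 2 * c + 1) ≡ 2 * suc p + 2 * c + 1
  arith = solve-∀

contract : ∀ μ n → n ≤ pairs μ → ∃[ bs ] Contract μ bs × length bs + n ≡ length μ × count bs ≡ count μ + n
contract [] zero le = _ , [] , refl , refl
contract (true ∷ μ) n le with contract μ n le
... | bs , c , len , cnt = true ∷ bs , leaf c , cong suc len , cong suc cnt
contract (false ∷ []) zero le = _ , bare [] , refl , refl
contract (false ∷ true ∷ μ) n le with contract μ n le
... | bs , c , len , cnt = _ , bare (leaf c) , cong (2 +_) len , cong suc cnt
contract (false ∷ false ∷ μ) zero le with contract μ zero z≤n
... | bs , c , len , cnt = _ , bare (bare c) , cong (2 +_) len , cnt
contract (false ∷ false ∷ μ) (suc n) le with contract μ n (s≤s⁻¹ le)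
... | bs , c , len , cnt = _ , loop c , cong suc (trans (+-suc (length bs) n) (cong suc len)) , trans (cong suc cnt) (sym (+-suc (count μ) n))

-- Drawings in small graphs

triangle : ℕ → ℕ
triangle n = suc n C 2

triangle-suc : ∀ n → triangle (suc n) ≡ suc n + triangle n
triangle-suc n = trans (sym (nCk+nC[k+1]≡[n+1]C[k+1] (suc n) 1)) (cong (_+ triangle n) (nC1≡n (suc n)))

triangle-odd : ∀ j → triangle (suc (2 * j)) ≡ suc j * suc (2 * j)
triangle-odd zero = refl
triangle-odd (suc j) = trans (cong (λ n → triangle (suc n)) (*-suc 2 j))
  (trans (triangle-suc (suc (suc (2 * j)))) (trans (cong (suc (suc (suc (2 * j))) +_)
    (trans (triangle-suc (suc (2 * j))) (cong (suc (suc (2 * j)) +_) (triangle-odd j)))) (arith j)))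
  where
  arith : ∀ j → suc (suc (suc (2 * j))) + (suc (suc (2 * j)) + suc j * suc (2 * j)) ≡ suc (suc j) * suc (2 * suc j)
  arith = solve-∀

draw : ∀ k μ spine tips → Maybe (Drawing k μ)
draw k μ spine tips
  with length spine ≟ suc (length μ) | length tips ≟ length μ | all? (_<? k) spine | all? (_<? k) tips
     | uniqueEdges? (trail spine ++ hairs μ spine tips)
... | yes a | yes b | yes c | yes d | yes e = just (mkDrawing spine tips a b c d e)
... | _ | _ | _ | _ | _ = nothing

attempts : ∀ k μ → List (List ℕ × List ℕ) → Maybe (Drawing k μ)
attempts k μ [] = nothing
attempts k μ ((spine , tips) ∷ ds) = draw k μ spine tips orElse attempts k μ ds

loops-only : List ℕ → ℕ → List ℕ × List ℕ
loops-only vs v = vs ++ [ v ] , vs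

drawings-3 : List (List ℕ × List ℕ)
drawings-3 = loops-only (0 ∷ 0 ∷ 1 ∷ 1 ∷ 2 ∷ 2 ∷ []) 0
           ∷ loops-only (0 ∷ 1 ∷ 2 ∷ 2 ∷ 0 ∷ []) 0
           ∷ loops-only (0 ∷ 0 ∷ 1 ∷ 2 ∷ 2 ∷ []) 0
           ∷ loops-only (0 ∷ 2 ∷ 2 ∷ 1 ∷ 0 ∷ []) 0
           ∷ loops-only (0 ∷ 0 ∷ 2 ∷ 2 ∷ 1 ∷ []) 0
           ∷ loops-only (0 ∷ 1 ∷ 2 ∷ 0 ∷ []) 0
           ∷ loops-only (0 ∷ 0 ∷ 1 ∷ 2 ∷ []) 0
           ∷ []

alternating : List Bool → Bool
alternating (true ∷ false ∷ true ∷ []) = true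
alternating _ = false

Drawing-3 : List Bool → Set
Drawing-3 μ = T (alternating μ) ⊎ Drawing 3 (false ∷ μ)

drawing-3? : ∀ μ → Maybe (Drawing-3 μ)
drawing-3? μ with attempts 3 (false ∷ μ) drawings-3 | alternating μ
... | just d | _ = just (inj₂ d)
... | nothing | true = just (inj₁ tt)
... | nothing | false = nothing

-- K_3^* has 6 edges: m go to leaves and one to the spine edge at the leading unmarked position,
-- hence the length 5 ∸ m. For K_5^* the 15 edges give 14 ∸ m in the same way.
drawing-3 : ∀ μ m → m ≤ 3 → length μ ≡ 5 ∸ m → count μ ≡ m → Drawing-3 μ
drawing-3 μ 0 _ = everySolution 5 0 drawing-3? tt μ
drawing-3 μ 1 _ = everySolution 4 1 drawing-3? tt μ
drawing-3 μ 2 _ = everySolution 3 2 drawing-3? tt μ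
drawing-3 μ 3 _ = everySolution 2 3 drawing-3? tt μ
drawing-3 μ (suc (suc (suc (suc m)))) (s≤s (s≤s (s≤s ())))

-- Five marks in exceptional position: here leaf edges other than loops are needed.
drawings-5 : List (List ℕ × List ℕ)
drawings-5 =
             ((0 ∷ 0 ∷ 2 ∷ 2 ∷ 4 ∷ 1 ∷ 3 ∷ 3 ∷ 0 ∷ 4 ∷ 4 ∷ []) , (0 ∷ 1 ∷ 1 ∷ 3 ∷ 4 ∷ 1 ∷ 3 ∷ 3 ∷ 0 ∷ 3 ∷ []))
           ∷ ((0 ∷ 0 ∷ 2 ∷ 2 ∷ 3 ∷ 3 ∷ 1 ∷ 1 ∷ 4 ∷ 4 ∷ 2 ∷ []) , (0 ∷ 1 ∷ 1 ∷ 2 ∷ 0 ∷ 4 ∷ 1 ∷ 1 ∷ 0 ∷ 4 ∷ []))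
           ∷ ((0 ∷ 0 ∷ 2 ∷ 2 ∷ 3 ∷ 1 ∷ 4 ∷ 0 ∷ 3 ∷ 4 ∷ 4 ∷ []) , (0 ∷ 1 ∷ 1 ∷ 2 ∷ 3 ∷ 1 ∷ 4 ∷ 0 ∷ 3 ∷ 2 ∷ []))
           ∷ ((0 ∷ 0 ∷ 2 ∷ 1 ∷ 3 ∷ 3 ∷ 0 ∷ 4 ∷ 4 ∷ 2 ∷ 2 ∷ []) , (0 ∷ 1 ∷ 2 ∷ 1 ∷ 2 ∷ 4 ∷ 0 ∷ 1 ∷ 4 ∷ 2 ∷ []))
           ∷ ((0 ∷ 0 ∷ 2 ∷ 1 ∷ 1 ∷ 4 ∷ 3 ∷ 3 ∷ 2 ∷ 4 ∷ 4 ∷ []) , (0 ∷ 1 ∷ 2 ∷ 1 ∷ 3 ∷ 0 ∷ 3 ∷ 0 ∷ 2 ∷ 4 ∷ []))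
           ∷ ((0 ∷ 0 ∷ 2 ∷ 1 ∷ 1 ∷ 3 ∷ 3 ∷ 2 ∷ 4 ∷ 4 ∷ 3 ∷ []) , (0 ∷ 1 ∷ 2 ∷ 1 ∷ 1 ∷ 0 ∷ 3 ∷ 2 ∷ 0 ∷ 1 ∷ []))
           ∷ ((0 ∷ 0 ∷ 1 ∷ 2 ∷ 2 ∷ 3 ∷ 3 ∷ 1 ∷ 4 ∷ 4 ∷ 2 ∷ []) , (0 ∷ 0 ∷ 1 ∷ 0 ∷ 2 ∷ 0 ∷ 4 ∷ 1 ∷ 4 ∷ 0 ∷ []))
           ∷ ((0 ∷ 0 ∷ 1 ∷ 2 ∷ 0 ∷ 4 ∷ 2 ∷ 3 ∷ 3 ∷ 4 ∷ 4 ∷ []) , (0 ∷ 0 ∷ 1 ∷ 2 ∷ 3 ∷ 1 ∷ 2 ∷ 3 ∷ 1 ∷ 4 ∷ []))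
           ∷ ((0 ∷ 0 ∷ 1 ∷ 2 ∷ 3 ∷ 0 ∷ 2 ∷ 4 ∷ 4 ∷ 3 ∷ 3 ∷ []) , (0 ∷ 0 ∷ 1 ∷ 2 ∷ 3 ∷ 4 ∷ 2 ∷ 4 ∷ 1 ∷ 1 ∷ []))
           ∷ ((0 ∷ 0 ∷ 1 ∷ 1 ∷ 3 ∷ 0 ∷ 2 ∷ 3 ∷ 4 ∷ 4 ∷ 2 ∷ []) , (0 ∷ 0 ∷ 1 ∷ 2 ∷ 3 ∷ 4 ∷ 2 ∷ 3 ∷ 4 ∷ 1 ∷ []))
           ∷ []

Contraction-5 : List Bool → Set
Contraction-5 μ = ∃[ bs ] Contract μ bs × length bs ≡ 10 × count bs ≡ 5 × T (not (exceptional bs))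

ordinary? : ∀ bs → Maybe (T (not (exceptional bs)))
ordinary? bs with exceptional bs
... | true = nothing
... | false = just tt

contractions : ∀ {A : Set} μ → (∀ {bs} → Contract μ bs → Maybe A) → Maybe A
contractions [] f = f []
contractions (true ∷ μ) f = contractions μ (f ∘ leaf)
contractions (false ∷ []) f = f (bare [])
contractions (false ∷ true ∷ μ) f = contractions μ (f ∘ bare ∘ leaf)
contractions (false ∷ false ∷ μ) f =
  contractions μ (f ∘ loop) orElse contractions (false ∷ μ) (f ∘ bare)

contraction-5 : ∀ μ → Maybe (Contraction-5 μ)
contraction-5 μ = contractions μ λ {bs} c → check c (length bs ≟ 10)
  where
  check : ∀ {bs} → Contract μ bs → Dec (length bs ≡ 10) → Maybe (Contraction-5 μ)
  check {bs} c (no _) = nothing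
  check {bs} c (yes len) with count bs ≟ 5 | ordinary? bs
  ... | yes five | just ok = just (bs , c , len , five , ok)
  ... | _ | _ = nothing

drawing-5? : ∀ μ → Maybe (Drawing 5 (false ∷ μ))
drawing-5? μ with contraction-5 (false ∷ μ)
... | just (bs , c , len , five , ok) = just (contract-drawing c (subst (1 ≤_) (sym len) (s≤s z≤n)) (tour-5 bs len five ok))
-- Reached only with five leaves, where there is nothing to contract. Each of the two exceptional
-- patterns has five rotations that start with an unmarked bit, which makes ten cases.
... | nothing = attempts 5 (false ∷ μ) drawings-5

abstract
  drawing-5 : ∀ μ m → m ≤ 5 → length μ ≡ 14 ∸ m → count μ ≡ m → Drawing 5 (false ∷ μ)
  drawing-5 μ 0 _ = everySolution 14 0 drawing-5? tt μ
  drawing-5 μ 1 _ = everySolution 13 1 drawing-5? tt μ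
  drawing-5 μ 2 _ = everySolution 12 2 drawing-5? tt μ
  drawing-5 μ 3 _ = everySolution 11 3 drawing-5? tt μ
  drawing-5 μ 4 _ = everySolution 10 4 drawing-5? tt μ
  drawing-5 μ 5 _ = everySolution 9 5 drawing-5? tt μ
  drawing-5 μ (suc (suc (suc (suc (suc (suc m)))))) (s≤s (s≤s (s≤s (s≤s (s≤s ())))))

drawing-large : ∀ q μ → length μ + count μ ≡ size q + order q → count μ ≤ order q → Drawing (order q) μ
drawing-large q μ total m≤k = contract-drawing c nonempty (tours q bs bs-length bs-count)
  where
  k = order q
  n = k ∸ count μ
  n+m≡k : n + count μ ≡ k
  n+m≡k = m∸n+n≡m m≤k
  μ-length : length μ ≡ size q + n
  μ-length = +-cancelʳ-≡ (count μ) _ _ (trans total (trans (cong (size q +_) (sym n+m≡k)) (sym (+-assoc (size q) n (count μ)))))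
  -- With fewer than n pairs, `length≤pairs` would give 1 + `size q` ≤ 2 n + 2 `count μ` = 2 k,
  -- while `size q` = k (3 + q) is at least 2 k.
  enough : n ≤ pairs μ
  enough = ≮⇒≥ λ p<n → <⇒≱ (≤-trans (s≤s (m≤m+n (size q) n)) (≤-trans (≤-reflexive (cong suc (sym μ-length)))
    (≤-trans (s≤s (length≤pairs μ)) (≤-trans (≤-reflexive (shift₂ (pairs μ) (count μ)))
      (≤-trans (+-monoˡ-≤ (2 * count μ) (*-monoʳ-≤ 2 p<n)) (≤-reflexive (trans (sym (*-distribˡ-+ 2 n (count μ))) (cong (2 *_) n+m≡k))))))))
    (subst (2 * k ≤_) (sym size-order) (≤-trans (≤-reflexive (*-comm 2 k)) (*-monoʳ-≤ k {2} {3 + q} (s≤s (s≤s z≤n)))))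
    where
    shift₂ : ∀ p m → suc (2 * p + 2 * m + 1) ≡ 2 * suc p + 2 * m
    shift₂ = solve-∀
    size-order : size q ≡ k * (3 + q)
    size-order = size≡ q
  found = contract μ n enough
  bs = proj₁ found
  c = proj₁ (proj₂ found)
  bs-length : length bs ≡ size q
  bs-length = +-cancelʳ-≡ n _ _ (trans (proj₁ (proj₂ (proj₂ found))) μ-length)
  bs-count : count bs ≡ k
  bs-count = trans (proj₂ (proj₂ (proj₂ found))) (trans (+-comm (count μ) n) n+m≡k)
  nonempty : 1 ≤ length bs
  nonempty = subst (1 ≤_) (sym bs-length) (s≤s z≤n)

-- Drawings and embeddings

edgeCode : ∀ {k} → Fin k × Fin k → Edge
edgeCode (a , b) = edge (toℕ a) (toℕ b)

samePair⇒≡ : ∀ {k} (p q : Fin k × Fin k) → SamePair p q → edgeCode p ≡ edgeCode q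
samePair⇒≡ p q (inj₁ (refl , refl)) = refl
samePair⇒≡ (a , b) q (inj₂ (refl , refl)) = edge-comm (toℕ a) (toℕ b)

≡⇒samePair : ∀ {k} (p q : Fin k × Fin k) → edgeCode p ≡ edgeCode q → SamePair p q
≡⇒samePair (a , b) (c , d) eq with edge-injective (toℕ a) (toℕ b) (toℕ c) (toℕ d) eq
... | inj₁ (p , q) = inj₁ (toℕ-injective p , toℕ-injective q)
... | inj₂ (p , q) = inj₂ (toℕ-injective p , toℕ-injective q)

-- Numbers the pairs b ≤ a by their larger entry: `triangle a` of them have a larger entry below a.
rank : Edge → ℕ
rank (a , b) = triangle a + b

triangle-mono : ∀ {m n} → m ≤ n → triangle m ≤ triangle n
triangle-mono {m} {n} m≤n = subst (λ x → triangle m ≤ triangle x) (m∸n+n≡m m≤n) (up (n ∸ m))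
  where
  up : ∀ d → triangle m ≤ triangle (d + m)
  up zero = ≤-refl
  up (suc d) = ≤-trans (up d) (≤-trans (m≤n+m _ (suc (d + m))) (≤-reflexive (sym (triangle-suc (d + m)))))

rank< : ∀ {a b} → b ≤ a → rank (a , b) < triangle (suc a)
rank< {a} {b} b≤a = subst (rank (a , b) <_) (sym (triangle-suc a))
  (≤-trans (+-monoʳ-< (triangle a) (s≤s b≤a)) (≤-reflexive (+-comm (triangle a) (suc a))))

rank-injective : ∀ {a b c d} → b ≤ a → d ≤ c → rank (a , b) ≡ rank (c , d) → (a , b) ≡ (c , d)
rank-injective {a} {b} {c} {d} b≤a d≤c eq with <-cmp a c
... | tri≈ _ refl _ = cong (a ,_) (+-cancelˡ-≡ (triangle a) b d eq)
... | tri< a<c _ _ = ⊥-elim (<-irrefl eq (≤-trans (rank< b≤a) (≤-trans (triangle-mono a<c) (m≤m+n (triangle c) d))))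
... | tri> _ _ c<a = ⊥-elim (<-irrefl (sym eq) (≤-trans (rank< d≤c) (≤-trans (triangle-mono c<a) (m≤m+n (triangle a) b))))

embeds⇒≤ : ∀ {k ℓ m} (i : Fin m → Fin ℓ) → EmbedsIn (caterpillar ℓ m i) k → ℓ + m ≤ triangle k
embeds⇒≤ {k} {ℓ} {m} i (f , embedding) = injective⇒≤ {f = code} injective
  where
  G = caterpillar ℓ m i
  image : Fin (ℓ + m) → Fin k × Fin k
  image x = imgEdge G f (splitAt ℓ x)
  bound : ∀ (p : Fin k × Fin k) → rank (edgeCode p) < triangle k
  bound (a , b) = ≤-trans (rank< {toℕ a ⊔ toℕ b} (m⊓n≤m⊔n (toℕ a) (toℕ b)))
    (triangle-mono (⊔-lub (toℕ<n a) (toℕ<n b)))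
  code : Fin (ℓ + m) → Fin (triangle k)
  code x = fromℕ< (bound (image x))
  injective : ∀ {x y} → code x ≡ code y → x ≡ y
  injective {x} {y} eq = trans (sym (join-splitAt ℓ m x)) (trans (cong (join ℓ m)
    (embedding (splitAt ℓ x) (splitAt ℓ y) (≡⇒samePair (image x) (image y)
      (rank-injective (m⊓n≤m⊔n _ _) (m⊓n≤m⊔n _ _)
        (trans (sym (toℕ-fromℕ< (bound (image x)))) (trans (cong toℕ eq) (toℕ-fromℕ< (bound (image y)))))))))
    (join-splitAt ℓ m y))

-- Reading an embedding off a drawing

at : List ℕ → ℕ → ℕ
at [] i = 0
at (v ∷ vs) zero = v
at (v ∷ vs) (suc i) = at vs i

at-All : ∀ {k} {vs} → 0 < k → All (_< k) vs → ∀ i → at vs i < k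
at-All 0<k [] i = 0<k
at-All 0<k (p ∷ ps) zero = p
at-All 0<k (p ∷ ps) (suc i) = at-All 0<k ps i

spineEdge : List ℕ → ℕ → Edge
spineEdge vs i = edge (at vs i) (at vs (suc i))

spineEdge-∈ : ∀ vs i → suc i < length vs → spineEdge vs i ∈ trail vs
spineEdge-∈ (v ∷ []) i (s≤s ())
spineEdge-∈ (v ∷ w ∷ vs) zero lt = here refl
spineEdge-∈ (v ∷ w ∷ vs) (suc i) (s≤s lt) = there (spineEdge-∈ (w ∷ vs) i lt)

spineEdge-injective : ∀ vs → Unique (trail vs) → ∀ i j → suc i < length vs → suc j < length vs →
  spineEdge vs i ≡ spineEdge vs j → i ≡ j
spineEdge-injective (v ∷ []) un i j (s≤s ()) j<
spineEdge-injective (v ∷ w ∷ vs) (p ∷ un) zero zero i< j< eq = refl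
spineEdge-injective (v ∷ w ∷ vs) (p ∷ un) zero (suc j) i< (s≤s j<) eq =
  ⊥-elim (All.lookup p (spineEdge-∈ (w ∷ vs) j j<) eq)
spineEdge-injective (v ∷ w ∷ vs) (p ∷ un) (suc i) zero (s≤s i<) j< eq =
  ⊥-elim (All.lookup p (spineEdge-∈ (w ∷ vs) i i<) (sym eq))
spineEdge-injective (v ∷ w ∷ vs) (p ∷ un) (suc i) (suc j) (s≤s i<) (s≤s j<) eq =
  cong suc (spineEdge-injective (w ∷ vs) un i j i< j< eq)

hair : List ℕ → List ℕ → ℕ → Edge
hair vs xs p = edge (at xs p) (at vs p)

Long : List Bool → List ℕ → List ℕ → Set
Long μ vs xs = length μ ≤ length vs × length μ ≤ length xs

hair-∈ : ∀ μ vs xs → Long μ vs xs → ∀ p → nth μ p ≡ true → hair vs xs p ∈ hairs μ vs xs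
hair-∈ (true ∷ μ) (v ∷ vs) (x ∷ xs) (s≤s a , s≤s b) zero eq = here refl
hair-∈ (true ∷ μ) (v ∷ vs) (x ∷ xs) (s≤s a , s≤s b) (suc p) eq = there (hair-∈ μ vs xs (a , b) p eq)
hair-∈ (false ∷ μ) (v ∷ vs) (x ∷ xs) (s≤s a , s≤s b) (suc p) eq = hair-∈ μ vs xs (a , b) p eq

hair-injective : ∀ μ vs xs → Long μ vs xs → Unique (hairs μ vs xs) → ∀ p q → nth μ p ≡ true → nth μ q ≡ true →
  hair vs xs p ≡ hair vs xs q → p ≡ q
hair-injective (b ∷ μ) (v ∷ vs) (x ∷ xs) _ un zero zero mp mq eq = refl
hair-injective (true ∷ μ) (v ∷ vs) (x ∷ xs) (s≤s a , s≤s b) (h ∷ un) zero (suc q) mp mq eq =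
  ⊥-elim (All.lookup h (hair-∈ μ vs xs (a , b) q mq) eq)
hair-injective (true ∷ μ) (v ∷ vs) (x ∷ xs) (s≤s a , s≤s b) (h ∷ un) (suc p) zero mp mq eq =
  ⊥-elim (All.lookup h (hair-∈ μ vs xs (a , b) p mp) (sym eq))
hair-injective (true ∷ μ) (v ∷ vs) (x ∷ xs) (s≤s a , s≤s b) (h ∷ un) (suc p) (suc q) mp mq eq =
  cong suc (hair-injective μ vs xs (a , b) un p q mp mq eq)
hair-injective (false ∷ μ) (v ∷ vs) (x ∷ xs) (s≤s a , s≤s b) un (suc p) (suc q) mp mq eq =
  cong suc (hair-injective μ vs xs (a , b) un p q mp mq eq)

-- A drawing with a longer spine serves as well, since its first ℓ spine edges and the leaf edges
-- stay distinct. A drawing has one tip per position, so the attachment points have to be distinct.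
drawing⇒embeds : ∀ {k μ ℓ m} (i : Fin m → Fin ℓ) → 0 < k → (∀ t → nth μ (toℕ (i t)) ≡ true) →
  (∀ s t → toℕ (i s) ≡ toℕ (i t) → s ≡ t) → ℓ ≤ length μ → Drawing k μ → EmbedsIn (caterpillar ℓ m i) k
drawing⇒embeds {k} {μ} {ℓ} {m} i 0<k marked distinct ℓ≤ (mkDrawing vs xs vs-length xs-length vs<k xs<k un) = f , embedding
  where
  G = caterpillar ℓ m i
  vertex : Fin (suc ℓ) ⊎ Fin m → Fin k
  vertex (inj₁ j) = fromℕ< (at-All 0<k vs<k (toℕ j))
  vertex (inj₂ t) = fromℕ< (at-All 0<k xs<k (toℕ (i t)))
  f : Fin (suc ℓ + m) → Fin k
  f x = vertex (splitAt (suc ℓ) x)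
  f-spine : ∀ j → toℕ (f (j ↑ˡ m)) ≡ at vs (toℕ j)
  f-spine j rewrite splitAt-↑ˡ (suc ℓ) j m = toℕ-fromℕ< (at-All 0<k vs<k (toℕ j))
  f-leaf : ∀ t → toℕ (f (suc ℓ ↑ʳ t)) ≡ at xs (toℕ (i t))
  f-leaf t rewrite splitAt-↑ʳ (suc ℓ) m t = toℕ-fromℕ< (at-All 0<k xs<k (toℕ (i t)))
  code : EIdx G → Edge
  code (inj₁ j) = spineEdge vs (toℕ j)
  code (inj₂ t) = hair vs xs (toℕ (i t))
  code-correct : ∀ e → edgeCode (imgEdge G f e) ≡ code e
  code-correct (inj₁ j) = cong₂ edge (trans (f-spine (inject₁ j)) (cong (at vs) (toℕ-inject₁ j))) (f-spine (fsuc j))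
  code-correct (inj₂ t) = cong₂ edge (f-leaf t) (trans (f-spine (inject₁ (i t))) (cong (at vs) (toℕ-inject₁ (i t))))
  inside-spine : ∀ (j : Fin ℓ) → suc (toℕ j) < length vs
  inside-spine j = subst (suc (toℕ j) <_) (sym vs-length) (s<s (≤-trans (toℕ<n j) ℓ≤))
  long : Long μ vs xs
  long = subst (length μ ≤_) (sym vs-length) (n≤1+n _) , ≤-reflexive (sym xs-length)
  spine∩hairs : ∀ j t → code (inj₁ j) ≢ code (inj₂ t)
  spine∩hairs j t eq = Unique-++-disjoint (trail vs) un (spineEdge-∈ vs (toℕ j) (inside-spine j))
    (subst (_∈ hairs μ vs xs) (sym eq) (hair-∈ μ vs xs long (toℕ (i t)) (marked t)))
    where
    Unique-++-disjoint : ∀ (es : List Edge) {fs e} → Unique (es ++ fs) → e ∈ es → e ∈ fs → ⊥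
    Unique-++-disjoint (e ∷ es) (p ∷ un) (here refl) e∈fs = All.lookup p (∈-++⁺ʳ es e∈fs) refl
    Unique-++-disjoint (e ∷ es) (p ∷ un) (there e∈) e∈fs = Unique-++-disjoint es un e∈ e∈fs
  code-injective : ∀ e e′ → code e ≡ code e′ → e ≡ e′
  code-injective (inj₁ j) (inj₁ j′) eq = cong inj₁ (toℕ-injective
    (spineEdge-injective vs (Unique-++⁻ˡ (trail vs) un) (toℕ j) (toℕ j′) (inside-spine j) (inside-spine j′) eq))
  code-injective (inj₁ j) (inj₂ t) eq = ⊥-elim (spine∩hairs j t eq)
  code-injective (inj₂ t) (inj₁ j) eq = ⊥-elim (spine∩hairs j t (sym eq))
  code-injective (inj₂ s) (inj₂ t) eq = cong inj₂ (distinct s t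
    (hair-injective μ vs xs long (Unique-++⁻ʳ (trail vs) un) (toℕ (i s)) (toℕ (i t)) (marked s) (marked t) eq))
  embedding : IsEmbedding G k f
  embedding e e′ same = code-injective e e′ (trans (sym (code-correct e))
    (trans (samePair⇒≡ (imgEdge G f e) (imgEdge G f e′) same) (code-correct e′)))

-- The marked positions of a caterpillar

hit : ∀ {m ℓ} → (Fin m → Fin ℓ) → ℕ → Bool
hit {zero} i p = false
hit {suc m} i p = (toℕ (i fzero) ≡ᵇ p) ∨ hit (i ∘ fsuc) p

≡ᵇ-refl : ∀ n → (n ≡ᵇ n) ≡ true
≡ᵇ-refl zero = refl
≡ᵇ-refl (suc n) = ≡ᵇ-refl n

hit-complete : ∀ {m ℓ} (i : Fin m → Fin ℓ) t → hit i (toℕ (i t)) ≡ true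
hit-complete i fzero = cong (_∨ hit (i ∘ fsuc) (toℕ (i fzero))) (≡ᵇ-refl (toℕ (i fzero)))
hit-complete i (fsuc t) with toℕ (i fzero) ≡ᵇ toℕ (i (fsuc t))
... | true = refl
... | false = hit-complete (i ∘ fsuc) t

hit-sound : ∀ {m ℓ} (i : Fin m → Fin ℓ) p → hit i p ≡ true → ∃[ t ] toℕ (i t) ≡ p
hit-sound {suc m} i p eq with toℕ (i fzero) ≡ᵇ p in eq₀
... | true = fzero , ≡ᵇ⇒≡ _ _ (subst T (sym eq₀) tt)
... | false with hit-sound (i ∘ fsuc) p eq
...   | t , eq′ = fsuc t , eq′

nth-segment : ∀ f s n p → p < n → nth (segment f s n) p ≡ f (s + p)
nth-segment f s (suc n) zero lt = cong f (sym (+-identityʳ s))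
nth-segment f s (suc n) (suc p) (s≤s lt) = trans (nth-segment f (suc s) n p lt) (cong f (sym (+-suc s p)))

count-∨ : ∀ f g → (∀ p → f p ≡ true → g p ≡ true → ⊥) → ∀ s n →
  count (segment (λ p → f p ∨ g p) s n) ≡ count (segment f s n) + count (segment g s n)
count-∨ f g disjoint s zero = refl
count-∨ f g disjoint s (suc n) with f s in fs | g s in gs
... | true | true = ⊥-elim (disjoint s fs gs)
... | true | false = cong suc (count-∨ f g disjoint (suc s) n)
... | false | true = trans (cong suc (count-∨ f g disjoint (suc s) n)) (sym (+-suc _ _))
... | false | false = count-∨ f g disjoint (suc s) n

count-none : ∀ a s n → a < s → count (segment (a ≡ᵇ_) s n) ≡ 0
count-none a s zero lt = refl
count-none a s (suc n) lt with a ≡ᵇ s in eq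
... | true = ⊥-elim (<⇒≢ lt (≡ᵇ⇒≡ a s (subst T (sym eq) tt)))
... | false = count-none a (suc s) n (m<n⇒m<1+n lt)

count-single : ∀ a s n → s ≤ a → a < s + n → count (segment (a ≡ᵇ_) s n) ≡ 1
count-single a s zero s≤a a< = ⊥-elim (<⇒≱ (subst (a <_) (+-identityʳ s) a<) s≤a)
count-single a s (suc n) s≤a a< with a ≡ᵇ s in eq
... | true = cong suc (count-none a (suc s) n (s≤s (≤-reflexive (≡ᵇ⇒≡ a s (subst T (sym eq) tt)))))
... | false = count-single a (suc s) n (≤∧≢⇒< s≤a (λ { refl → case trans (sym (≡ᵇ-refl a)) eq of λ () }))
  (subst (a <_) (+-suc s n) a<)

count-false : ∀ s n → count (segment (λ _ → false) s n) ≡ 0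
count-false s zero = refl
count-false s (suc n) = count-false (suc s) n

count-hit : ∀ {m ℓ} (i : Fin m → Fin ℓ) → StrictlyIncreasing i → ∀ n → (∀ t → toℕ (i t) < n) → count (segment (hit i) 0 n) ≡ m
count-hit {zero} i inc n bound = count-false 0 n
count-hit {suc m} i inc n bound = trans (count-∨ (toℕ (i fzero) ≡ᵇ_) (hit (i ∘ fsuc)) disjoint 0 n)
  (cong₂ _+_ (count-single (toℕ (i fzero)) 0 n z≤n (bound fzero))
    (count-hit (i ∘ fsuc) (λ s t s<t → inc (fsuc s) (fsuc t) (s<s s<t)) n (bound ∘ fsuc)))
  where
  disjoint : ∀ p → (toℕ (i fzero) ≡ᵇ p) ≡ true → hit (i ∘ fsuc) p ≡ true → ⊥
  disjoint p eq h with hit-sound (i ∘ fsuc) p h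
  ... | t , eq′ = <⇒≢ (inc fzero (fsuc t) z<s) (trans (≡ᵇ⇒≡ _ _ (subst T (sym eq) tt)) (sym eq′))

increasing-injective : ∀ {m ℓ} (i : Fin m → Fin ℓ) → StrictlyIncreasing i → ∀ s t → toℕ (i s) ≡ toℕ (i t) → s ≡ t
increasing-injective i inc s t eq with <-cmp (toℕ s) (toℕ t)
... | tri< s<t _ _ = ⊥-elim (<⇒≢ (inc s t s<t) eq)
... | tri≈ _ s≡t _ = toℕ-injective s≡t
... | tri> _ _ t<s = ⊥-elim (<⇒≢ (inc t s t<s) (sym eq))

alternating-sound : ∀ μ → T (alternating μ) → μ ≡ true ∷ false ∷ true ∷ []
alternating-sound (true ∷ false ∷ true ∷ []) _ = refl

-- The pattern bounds the lengthened spine by 4, and a leaf at position 3 forces ℓ to be at least 4,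
-- so the given caterpillar is already the exceptional one and not a shorter one.
alternating⇒CP4-13 : ∀ {ℓ m} (i : Fin m → Fin ℓ) → StrictlyIncreasing i → ∀ n → T (alternating (segment (hit i) 1 n)) →
  m ≡ 2 → ℓ ≤ suc n → IsCP4-13 ℓ m i
alternating⇒CP4-13 {ℓ} i inc n alt refl ℓ≤ = ≤-antisym (subst (λ x → ℓ ≤ suc x) n≡3 ℓ≤) 4≤ℓ , refl , proj₁ ends-13 , proj₂ ends-13
  where
  shape : segment (hit i) 1 n ≡ true ∷ false ∷ true ∷ []
  shape = alternating-sound _ alt
  n≡3 : n ≡ 3
  n≡3 = trans (sym (length-segment (hit i) 1 n)) (cong length shape)
  hit-at : ∀ p → p < 3 → nth (true ∷ false ∷ true ∷ []) p ≡ true → hit i (suc p) ≡ true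
  hit-at p p<3 eq = trans (sym (nth-segment (hit i) 1 n p (subst (p <_) (sym n≡3) p<3))) (trans (cong (λ bs → nth bs p) shape) eq)
  ends-13 : toℕ (i fzero) ≡ 1 × toℕ (i (fsuc fzero)) ≡ 3
  ends-13 with hit-sound i 1 (hit-at 0 z<s refl) | hit-sound i 3 (hit-at 2 (s<s (s<s z<s)) refl)
  ... | fzero , i₀≡1 | fsuc fzero , i₁≡3 = i₀≡1 , i₁≡3
  ... | fzero , i₀≡1 | fzero , i₁≡3 = case trans (sym i₀≡1) i₁≡3 of λ ()
  ... | fsuc fzero , i₀≡1 | fsuc fzero , i₁≡3 = case trans (sym i₀≡1) i₁≡3 of λ ()
  ... | fsuc fzero , i₀≡1 | fzero , i₁≡3 = ⊥-elim (<⇒≱ (inc fzero (fsuc fzero) z<s) (subst₂ _≤_ (sym i₀≡1) (sym i₁≡3) (s≤s z≤n)))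
  4≤ℓ : 4 ≤ ℓ
  4≤ℓ = subst (_< ℓ) (proj₂ ends-13) (toℕ<n (i (fsuc fzero)))

-- Drawings for every odd order and the equivalence

drawing : ∀ j μ → let k = suc (2 * j) in count μ ≤ k → suc (length μ) + count μ ≡ triangle k →
  (k ≡ 3 × T (alternating μ)) ⊎ Drawing k (false ∷ μ)
drawing 0 [] _ _ = inj₂ (from-just (draw 1 (false ∷ []) (0 ∷ 0 ∷ []) (0 ∷ [])) tt)
drawing 0 (true ∷ μ) _ ()
drawing 0 (false ∷ μ) _ ()
drawing 1 μ m≤k total with drawing-3 μ (count μ) m≤k
    (trans (sym (m+n∸n≡m (length μ) (count μ))) (cong (_∸ count μ) (suc-injective total))) refl
... | inj₁ alt = inj₁ (refl , alt)
... | inj₂ d = inj₂ d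
drawing 2 μ m≤k total = inj₂ (drawing-5 μ (count μ) m≤k
  (trans (sym (m+n∸n≡m (length μ) (count μ))) (cong (_∸ count μ) (suc-injective total))) refl)
drawing (suc (suc (suc q))) μ m≤k total = inj₂ (subst (λ k → Drawing k (false ∷ μ)) (sym k≡)
  (drawing-large q (false ∷ μ) total′ (subst (count μ ≤_) k≡ m≤k)))
  where
  k≡ : suc (2 * (3 + q)) ≡ order q
  k≡ = arith q
    where
    arith : ∀ q → suc (2 * (3 + q)) ≡ 7 + q * 2
    arith = solve-∀
  total′ : suc (length μ) + count μ ≡ size q + order q
  total′ = trans total (trans (triangle-odd (3 + q)) (trans (cong ((4 + q) *_) k≡)
    (trans (*-comm (4 + q) (order q)) (trans (*-suc (order q) (3 + q))
      (trans (+-comm (order q) _) (cong (_+ order q) (sym (size≡ q))))))))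

theorem2p3 : (k ℓ m : ℕ) → OddNat k → 0 < k → 0 < ℓ → m ≤ k →
    (i : Fin m → Fin ℓ) → AllPositive i → StrictlyIncreasing i →
    ¬ IsCP4-13 ℓ m i →
    EmbedsIn (caterpillar ℓ m i) k ⇔ (ℓ + m ≤ suc k C 2)
theorem2p3 k ℓ m (j , refl) 0<k 0<ℓ m≤k i positive inc not-CP = mk⇔ (embeds⇒≤ i) embed
  where
  embed : ℓ + m ≤ triangle k → EmbedsIn (caterpillar ℓ m i) k
  embed le = drawing⇒embeds i 0<k marked (increasing-injective i inc) (subst (ℓ ≤_) (sym μ-length) ℓ≤1+n) drawn
    where
    ℓ≤ : ℓ ≤ triangle k ∸ m
    ℓ≤ = m+n≤o⇒m≤o∸n ℓ le
    -- The spine is lengthened until every edge of K_k^* is used. Position 0 is split off, being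
    -- unmarked because all attachment points are positive; `n` counts the other positions.
    n = pred (triangle k ∸ m)
    1+n≡ : suc n ≡ triangle k ∸ m
    1+n≡ = suc-pred (triangle k ∸ m) ⦃ >-nonZero (≤-trans 0<ℓ ℓ≤) ⦄
    ℓ≤1+n : ℓ ≤ suc n
    ℓ≤1+n = subst (ℓ ≤_) (sym 1+n≡) ℓ≤
    μ = segment (hit i) 1 n
    μ-length : length (false ∷ μ) ≡ suc n
    μ-length = cong suc (length-segment (hit i) 1 n)
    no-hit : hit i 0 ≡ false
    no-hit with hit i 0 in eq
    ... | false = refl
    ... | true with hit-sound i 0 eq
    ...   | t , eq′ = ⊥-elim (<⇒≢ (positive t) (sym eq′))
    leaf< : ∀ t → toℕ (i t) < suc n
    leaf< t = ≤-trans (toℕ<n (i t)) ℓ≤1+n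
    μ-count : count μ ≡ m
    μ-count = trans (cong (λ b → count (b ∷ μ)) (sym no-hit)) (count-hit i inc (suc n) leaf<)
    marked : ∀ t → nth (false ∷ μ) (toℕ (i t)) ≡ true
    marked t = trans (cong (λ b → nth (b ∷ μ) (toℕ (i t))) (sym no-hit))
      (trans (nth-segment (hit i) 0 (suc n) (toℕ (i t)) (leaf< t)) (hit-complete i t))
    total : suc (length μ) + count μ ≡ triangle k
    total = trans (cong₂ _+_ (trans μ-length 1+n≡) μ-count) (m∸n+n≡m (≤-trans (m≤n+m m ℓ) le))
    drawn : Drawing k (false ∷ μ)
    drawn with drawing j μ (subst (_≤ k) (sym μ-count) m≤k) total
    ... | inj₂ d = d
    ... | inj₁ (k≡3 , alt) = ⊥-elim (not-CP (alternating⇒CP4-13 i inc n alt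
      (trans (sym μ-count) (cong count (alternating-sound μ alt))) ℓ≤1+n))
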